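{- The problem ECI (given a time-inconsistent planning model $M=(G,w,s,t,p,\beta)$ and $W\ge 0$, compute $\Pr(X_\beta\le W)$) admits an algorithm with running time $\mathcal{O}(\lfloor W\cdot d(s,t)\rfloor\cdot n^2+n^3)$, where $n$ is the number of vertices of $G$.
   Context: A time-inconsistent planning model is a tuple $M=(G,w,s,t,p,\beta)$ where $G$ is a finite directed acyclic graph with $n$ vertices, $w:E(G)\to\mathbb{N}$ are arc costs, $s,t\in V(G)$ with $t$ reachable from $s$, and $\beta\le 1$ is the present-bias parameter. For a $v$-$t$ path $P$ with arcs $e_1,\dots,e_m$, its perceived cost is $\zeta(P)=w(e_1)+\beta\sum_{i=2}^m w(e_i)$; $\zeta(v)$ is the minimum perceived cost over all $v$-$t$ paths, and a $v$-$t$ path attaining it is a perceived path. The function $p$ assigns to each arc $uv$ a probability $p(u,v)\ge 0$ such that $\sum_{uv\in E(G)}p(u,v)=1$ for every vertex $u\ne t$ from which $t$ is reachable, and $p(u,v)>0$ only if $uv$ is the first arc of some perceived $u$-$t$ path. The agent starts at $s$ and at each vertex $u\neq t$ moves along arc $uv$ with probability $p(u,v)$, until it reaches $t$. $C_\beta$ is the random variable equal to the actual cost (sum of $w$) of the $s$-$t$ path traversed, $d(s,t)$ is the minimum cost of an $s$-$t$ path, and $X_\beta=C_\beta/d(s,t)$.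
   Formalization: The present-bias parameter β, the probabilities p(u,v) and the threshold W are taken to be rational numbers rather than real numbers, with exact rational arithmetic at unit cost. -}

module Defs where

open import Data.Bool.Base using (Bool; true; false; T; not; _∧_)
open import Data.Bool.Properties using (T-irrelevant)
open import Data.Empty using (⊥-elim)
open import Data.Fin.Base as Fin using (Fin; toℕ; fromℕ<; remQuot)
import Data.Fin.Properties as Fin
open import Data.Integer.Base using (+_; ∣_∣)
open import Data.List.Base using (List; []; _∷_; _++_; map; foldr; filter; concat; allFin)
open import Data.List.Membership.Propositional using (_∈_)
open import Data.List.Membership.Propositional.Properties using (∈-++⁺ˡ; ∈-++⁺ʳ; ∈-map⁺; ∈-map⁻; ∈-allFin; ∈-concat⁺′)
open import Data.List.Relation.Binary.Disjoint.Propositional using (Disjoint)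
import Data.List.Relation.Unary.All as All
import Data.List.Relation.Unary.All.Properties as All
import Data.List.Relation.Unary.AllPairs as AllPairs
import Data.List.Relation.Unary.AllPairs.Properties as AllPairs
open import Data.List.Relation.Unary.Any using (here)
open import Data.List.Relation.Unary.Unique.Propositional using (Unique)
import Data.List.Relation.Unary.Unique.Propositional.Properties as Unique
open import Data.Nat.Base as ℕ using (ℕ; zero; suc; z≤n; s≤s; NonZero)
import Data.Nat.Properties as ℕ
open import Data.Product.Base using (Σ-syntax; _×_; _,_; uncurry)
open import Data.Rational.Base as ℚ using (ℚ; 0ℚ; 1ℚ; floor)
import Data.Rational.Properties as ℚ
open import Relation.Binary.Construct.Closure.ReflexiveTransitive using (Star; ε; _◅_)
open import Relation.Binary.Construct.Closure.Transitive using (TransClosure; [_]; _∷_)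
open import Relation.Binary.PropositionalEquality using (_≡_; _≢_; refl; sym; subst)
open import Relation.Nullary using (¬_; yes; no)
open import Relation.Nullary.Decidable using (T?)
open import Relation.Unary using (Pred; Decidable)
open import Level using (0ℓ)

infix 8 _/1

_/1 : ℕ → ℚ
m /1 = + m ℚ./ 1

sumℚ : List ℚ → ℚ
sumℚ = foldr ℚ._+_ 0ℚ

------------------------------------------------------------------------
-- Directed acyclic graphs and their paths

-- The arc relation is a Boolean matrix, so there are no parallel arcs.
record DAG (n : ℕ) : Set where
  field
    adj : Fin n → Fin n → Bool

  Arc : Fin n → Fin n → Set
  Arc u v = T (adj u v)

  field
    acyclic : ∀ u → ¬ TransClosure Arc u u

  -- In an acyclic graph no walk repeats a vertex, so walks are paths.
  Path : Fin n → Fin n → Set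
  Path = Star Arc

  length : ∀ {u v} → Path u v → ℕ
  length ε       = 0
  length (_ ◅ P) = suc (length P)

  -- All paths from u to v with at most k arcs.
  paths≤    : ℕ → ∀ u v → List (Path u v)
  trivial   : ∀ u v → List (Path u v)
  paths≤via : ℕ → ∀ u v → Fin n → List (Path u v)

  paths≤ zero    u v = trivial u v
  paths≤ (suc k) u v = trivial u v ++ concat (map (paths≤via k u v) (allFin n))

  trivial u v with u Fin.≟ v
  ... | yes refl = ε ∷ []
  ... | no  _    = []

  paths≤via k u v x with T? (adj u x)
  ... | yes a = map (a ◅_) (paths≤ k x v)
  ... | no  _ = []

  -- This list contains every path exactly once: see ∈-paths and
  -- paths-unique below.
  paths : ∀ u v → List (Path u v)
  paths = paths≤ n

  private
    vertex : ∀ {u v} (P : Path u v) → Fin (suc (length P)) → Fin n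
    vertex {u} _       Fin.zero    = u
    vertex     (_ ◅ P) (Fin.suc i) = vertex P i

    segment : ∀ {u v} (P : Path u v) i j → i Fin.< j →
              TransClosure Arc (vertex P i) (vertex P j)
    segment (a ◅ P) Fin.zero (Fin.suc Fin.zero) _ = [ a ]
    segment (a ◅ P@(_ ◅ _)) Fin.zero (Fin.suc (Fin.suc j)) _ =
      a ∷ segment P Fin.zero (Fin.suc j) (s≤s z≤n)
    segment (a ◅ P) (Fin.suc i) (Fin.suc j) (s≤s i<j) = segment P i j i<j

    length<n : ∀ {u v} (P : Path u v) → length P ℕ.< n
    length<n P with n ℕ.≤? length P
    ... | no  n≰ℓ = ℕ.≰⇒> n≰ℓ
    ... | yes n≤ℓ with i , j , i<j , eq ← Fin.pigeonhole (s≤s n≤ℓ) (vertex P) =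
      ⊥-elim (acyclic _ (subst (TransClosure Arc _) (sym eq) (segment P i j i<j)))

    ε∈trivial : ∀ u → ε ∈ trivial u u
    ε∈trivial u with u Fin.≟ u
    ... | yes refl = here refl
    ... | no  u≢u  = ⊥-elim (u≢u refl)

    ∈-paths≤ : ∀ k {u v} (P : Path u v) → length P ℕ.≤ k → P ∈ paths≤ k u v
    ∈-via    : ∀ k {u x v} (a : Arc u x) (P : Path x v) → length P ℕ.≤ k →
               (a ◅ P) ∈ paths≤via k u v x

    ∈-paths≤ zero    {u} ε _ = ε∈trivial u
    ∈-paths≤ (suc k) {u} ε _ = ∈-++⁺ˡ (ε∈trivial u)
    ∈-paths≤ (suc k) {u} {v} (_◅_ {j = x} a P) (s≤s ℓ≤k) =
      ∈-++⁺ʳ (trivial u v)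
        (∈-concat⁺′ (∈-via k a P ℓ≤k) (∈-map⁺ (paths≤via k u v) (∈-allFin x)))

    ∈-via k {u} {x} a P ℓ≤k with T? (adj u x)
    ... | no  ¬a = ⊥-elim (¬a a)
    ... | yes a′ rewrite T-irrelevant a a′ = ∈-map⁺ (a′ ◅_) (∈-paths≤ k P ℓ≤k)

    data Via {u v} (x : Fin n) : Path u v → Set where
      via : (a : Arc u x) (P : Path x v) → Via x (a ◅ P)

    ∈-via⁻ : ∀ k {u v} x {P : Path u v} → P ∈ paths≤via k u v x → Via x P
    ∈-via⁻ k {u} {v} x P∈ with T? (adj u x)
    ... | yes a with Q , _ , refl ← ∈-map⁻ (a ◅_) P∈ = via a Q

    via-functional : ∀ {u v x y} {P : Path u v} → Via x P → Via y P → x ≡ y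
    via-functional (via _ _) (via _ _) = refl

    trivial-unique : ∀ u v → Unique (trivial u v)
    trivial-unique u v with u Fin.≟ v
    ... | yes refl = All.[] AllPairs.∷ AllPairs.[]
    ... | no  _    = AllPairs.[]

    trivial-not-via : ∀ {u v x} {P : Path u v} → P ∈ trivial u v → ¬ Via x P
    trivial-not-via {u} {v} P∈ P-via with u Fin.≟ v
    trivial-not-via (here refl) () | yes refl

    via-disjoint : ∀ k u v x y → x ≢ y →
      Disjoint (paths≤via k u v x) (paths≤via k u v y)
    via-disjoint k u v x y x≢y (P∈ , P∈′) =
      x≢y (via-functional (∈-via⁻ k x P∈) (∈-via⁻ k y P∈′))

    trivial-disjoint : ∀ k u v xs →
      Disjoint (trivial u v) (concat (map (paths≤via k u v) xs))
    trivial-disjoint k u v xs (P∈ , P∈′) =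
      All.lookup (All.concat⁺ (All.map⁺ (All.universal
        (λ x → All.tabulate (λ Q∈ Q∈trivial → trivial-not-via Q∈trivial (∈-via⁻ k x Q∈))) xs)))
        P∈′ P∈

    paths≤-unique : ∀ k u v → Unique (paths≤ k u v)
    via-unique    : ∀ k u v x → Unique (paths≤via k u v x)

    paths≤-unique zero    u v = trivial-unique u v
    paths≤-unique (suc k) u v =
      Unique.++⁺ (trivial-unique u v)
        (Unique.concat⁺
          (All.map⁺ (All.universal (via-unique k u v) (allFin n)))
          (AllPairs.map⁺ (AllPairs.map
            {S = λ x y → Disjoint (paths≤via k u v x) (paths≤via k u v y)}
            (λ {x} {y} → via-disjoint k u v x y)
            (Unique.allFin⁺ n))))
        (trivial-disjoint k u v (allFin n))

    via-unique k u v x with T? (adj u x)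
    ... | yes a = Unique.map⁺ (λ { refl → refl }) (paths≤-unique k x v)
    ... | no  _ = AllPairs.[]

  ∈-paths : ∀ {u v} (P : Path u v) → P ∈ paths u v
  ∈-paths P = ∈-paths≤ n P (ℕ.<⇒≤ (length<n P))

  paths-unique : ∀ u v → Unique (paths u v)
  paths-unique = paths≤-unique n

------------------------------------------------------------------------
-- Time-inconsistent planning models

-- The labels w and p are total matrices; only their values at arcs are
-- ever constrained or used.
record RawModel (n : ℕ) : Set where
  field
    G   : DAG n
    w   : Fin n → Fin n → ℕ
    s t : Fin n
    p   : Fin n → Fin n → ℚ
    β   : ℚ

  open DAG G public

  cost : ∀ {u v} → Path u v → ℕ
  cost ε                 = 0
  cost (_◅_ {u} {x} _ P) = w u x ℕ.+ cost P

  ζ : ∀ {u} → Path u t → ℚ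
  ζ ε                 = 0ℚ
  ζ (_◅_ {u} {x} _ P) = w u x /1 ℚ.+ β ℚ.* cost P /1

  Perceived : ∀ {u} → Path u t → Set
  Perceived {u} P = ∀ (Q : Path u t) → ζ P ℚ.≤ ζ Q

  IsDistance : Fin n → Fin n → ℕ → Set
  IsDistance u v d = (Σ[ P ∈ Path u v ] cost P ≡ d) × (∀ (P : Path u v) → d ℕ.≤ cost P)

record Model (n : ℕ) : Set where
  field
    rawModel : RawModel n

  open RawModel rawModel public

  field
    s-reaches-t : Path s t
    β≤1         : β ℚ.≤ 1ℚ
    p-nonneg    : ∀ {u v} → Arc u v → 0ℚ ℚ.≤ p u v
    p-sum       : ∀ {u} → u ≢ t → Path u t →
                  sumℚ (map (p u) (filter (λ v → T? (adj u v)) (allFin n))) ≡ 1ℚ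
    p-perceived : ∀ {u v} (a : Arc u v) → 0ℚ ℚ.< p u v →
                  Σ[ P ∈ Path v t ] Perceived (a ◅ P)

  -- The sample space is the finite set of s-t paths. By acyclicity a path
  -- visits t only at its end, so the agent traverses a given s-t path with
  -- probability equal to the product of the p-values of its arcs.
  prob : ∀ {u v} → Path u v → ℚ
  prob ε                 = 1ℚ
  prob (_◅_ {u} {x} _ P) = p u x ℚ.* prob P

  Pr : {A : Pred (Path s t) 0ℓ} → Decidable A → ℚ
  Pr A? = sumℚ (map prob (filter A? (paths s t)))

  C : Path s t → ℕ
  C = cost

  -- C divided by d, to be used with d the distance from s to t.
  X : (d : ℕ) .{{_ : NonZero d}} → Path s t → ℚ
  X d P = + C P ℚ./ d

  Pr[X_≤_] : (d : ℕ) .{{_ : NonZero d}} → ℚ → ℚ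
  Pr[X d ≤ W ] = Pr (λ P → X d P ℚ.≤? W)

------------------------------------------------------------------------
-- The machine model
--
-- Structured programs for a unit-cost RAM with two memories, one for
-- natural numbers and one for exact rationals. Each memory consists of
-- arrays named by numerals fixed in the program text, with computed
-- indices; scalars are array cells. Every literal, memory access,
-- arithmetic operation, comparison, connective, cast and control transfer
-- costs one step. To keep unit cost honest on unbounded numbers there is
-- no multiplication on natural numbers and no instruction going from
-- rationals back to natural numbers (in particular no rounding).

infixl 9 _[_]ᴺ _[_]ᴿ
infixl 7 _⊗_
infixl 6 _⊕_ _⊖_ _⊞_ _⊟_
infix  5 _≤ᴺ_ _≤ᴿ_
infix  4 _[_]≔ᴺ_ _[_]≔ᴿ_
infixr 3 _⨾_

data NExp : Set where
  lit    : ℕ → NExp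
  _[_]ᴺ  : ℕ → NExp → NExp
  _⊕_ _⊖_ : NExp → NExp → NExp

data RExp : Set where
  cast        : NExp → RExp
  _[_]ᴿ       : ℕ → NExp → RExp
  _⊞_ _⊟_ _⊗_ : RExp → RExp → RExp

data BExp : Set where
  _≤ᴺ_ : NExp → NExp → BExp
  _≤ᴿ_ : RExp → RExp → BExp
  neg  : BExp → BExp
  _and_ : BExp → BExp → BExp

data Program : Set where
  skip            : Program
  _[_]≔ᴺ_         : ℕ → NExp → NExp → Program
  _[_]≔ᴿ_         : ℕ → NExp → RExp → Program
  _⨾_             : Program → Program → Program
  if_then_else_   : BExp → Program → Program → Program
  while_loop_     : BExp → Program → Program

record Store : Set where
  constructor store
  field
    nat : ℕ → ℕ → ℕ
    rat : ℕ → ℕ → ℚ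

open Store public

update : ∀ {A : Set} → (ℕ → ℕ → A) → ℕ → ℕ → A → (ℕ → ℕ → A)
update m a i x b j with a ℕ.≟ b | i ℕ.≟ j
... | yes _ | yes _ = x
... | _     | _     = m b j

evalᴺ : NExp → Store → ℕ
evalᴺ (lit k)    σ = k
evalᴺ (a [ e ]ᴺ) σ = nat σ a (evalᴺ e σ)
evalᴺ (e ⊕ f)    σ = evalᴺ e σ ℕ.+ evalᴺ f σ
evalᴺ (e ⊖ f)    σ = evalᴺ e σ ℕ.∸ evalᴺ f σ

evalᴿ : RExp → Store → ℚ
evalᴿ (cast e)   σ = evalᴺ e σ /1
evalᴿ (a [ e ]ᴿ) σ = rat σ a (evalᴺ e σ)
evalᴿ (e ⊞ f)    σ = evalᴿ e σ ℚ.+ evalᴿ f σ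
evalᴿ (e ⊟ f)    σ = evalᴿ e σ ℚ.- evalᴿ f σ
evalᴿ (e ⊗ f)    σ = evalᴿ e σ ℚ.* evalᴿ f σ

evalᴮ : BExp → Store → Bool
evalᴮ (e ≤ᴺ f)  σ = evalᴺ e σ ℕ.≤ᵇ evalᴺ f σ
evalᴮ (e ≤ᴿ f)  σ = evalᴿ e σ ℚ.≤ᵇ evalᴿ f σ
evalᴮ (neg b)   σ = not (evalᴮ b σ)
evalᴮ (b and c) σ = evalᴮ b σ ∧ evalᴮ c σ

stepsᴺ : NExp → ℕ
stepsᴺ (lit _)    = 1
stepsᴺ (_ [ e ]ᴺ) = 1 ℕ.+ stepsᴺ e
stepsᴺ (e ⊕ f)    = 1 ℕ.+ stepsᴺ e ℕ.+ stepsᴺ f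
stepsᴺ (e ⊖ f)    = 1 ℕ.+ stepsᴺ e ℕ.+ stepsᴺ f

stepsᴿ : RExp → ℕ
stepsᴿ (cast e)   = 1 ℕ.+ stepsᴺ e
stepsᴿ (_ [ e ]ᴿ) = 1 ℕ.+ stepsᴺ e
stepsᴿ (e ⊞ f)    = 1 ℕ.+ stepsᴿ e ℕ.+ stepsᴿ f
stepsᴿ (e ⊟ f)    = 1 ℕ.+ stepsᴿ e ℕ.+ stepsᴿ f
stepsᴿ (e ⊗ f)    = 1 ℕ.+ stepsᴿ e ℕ.+ stepsᴿ f

stepsᴮ : BExp → ℕ
stepsᴮ (e ≤ᴺ f)  = 1 ℕ.+ stepsᴺ e ℕ.+ stepsᴺ f
stepsᴮ (e ≤ᴿ f)  = 1 ℕ.+ stepsᴿ e ℕ.+ stepsᴿ f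
stepsᴮ (neg b)   = 1 ℕ.+ stepsᴮ b
stepsᴮ (b and c) = 1 ℕ.+ stepsᴮ b ℕ.+ stepsᴮ c

-- ⟨ c , σ ⟩⇓⟨ τ , k ⟩: started in σ, the program c halts in τ after
-- exactly k steps.
infix 2 ⟨_,_⟩⇓⟨_,_⟩

data ⟨_,_⟩⇓⟨_,_⟩ : Program → Store → Store → ℕ → Set where

  ⇓skip : ∀ {σ} → ⟨ skip , σ ⟩⇓⟨ σ , 1 ⟩

  ⇓assignᴺ : ∀ {a i e σ} →
    ⟨ a [ i ]≔ᴺ e , σ ⟩⇓⟨ store (update (nat σ) a (evalᴺ i σ) (evalᴺ e σ)) (rat σ)
                        , 1 ℕ.+ stepsᴺ i ℕ.+ stepsᴺ e ⟩

  ⇓assignᴿ : ∀ {a i e σ} →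
    ⟨ a [ i ]≔ᴿ e , σ ⟩⇓⟨ store (nat σ) (update (rat σ) a (evalᴺ i σ) (evalᴿ e σ))
                        , 1 ℕ.+ stepsᴺ i ℕ.+ stepsᴿ e ⟩

  ⇓seq : ∀ {c d σ τ υ k l} →
    ⟨ c , σ ⟩⇓⟨ τ , k ⟩ → ⟨ d , τ ⟩⇓⟨ υ , l ⟩ → ⟨ c ⨾ d , σ ⟩⇓⟨ υ , k ℕ.+ l ⟩

  ⇓then : ∀ {b c d σ τ k} → evalᴮ b σ ≡ true →
    ⟨ c , σ ⟩⇓⟨ τ , k ⟩ → ⟨ if b then c else d , σ ⟩⇓⟨ τ , 1 ℕ.+ stepsᴮ b ℕ.+ k ⟩

  ⇓else : ∀ {b c d σ τ k} → evalᴮ b σ ≡ false →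
    ⟨ d , σ ⟩⇓⟨ τ , k ⟩ → ⟨ if b then c else d , σ ⟩⇓⟨ τ , 1 ℕ.+ stepsᴮ b ℕ.+ k ⟩

  ⇓exit : ∀ {b c σ} → evalᴮ b σ ≡ false →
    ⟨ while b loop c , σ ⟩⇓⟨ σ , 1 ℕ.+ stepsᴮ b ⟩

  ⇓iterate : ∀ {b c σ τ υ k l} → evalᴮ b σ ≡ true →
    ⟨ c , σ ⟩⇓⟨ τ , k ⟩ → ⟨ while b loop c , τ ⟩⇓⟨ υ , l ⟩ →
    ⟨ while b loop c , σ ⟩⇓⟨ υ , 1 ℕ.+ stepsᴮ b ℕ.+ k ℕ.+ l ⟩

------------------------------------------------------------------------
-- Input and output conventions for ECI

-- Row-major layout: entry (u , v) of the matrix is at index n * u + v.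
rowMajor : ∀ {A : Set} {n} → A → (Fin n → Fin n → A) → ℕ → A
rowMajor {n = n} default f i with i ℕ.<? n ℕ.* n
... | yes i<n² = uncurry f (remQuot n (fromℕ< i<n²))
... | no  _    = default

bit : Bool → ℕ
bit false = 0
bit true  = 1

-- All cells not holding input are zero. Neither d(s,t) nor a topological
-- order is part of the input.
input : ∀ {n} → Model n → ℚ → Store
input {n} M W = store natInput ratInput
  where
  open Model M

  natInput : ℕ → ℕ → ℕ
  natInput 0 0 = n
  natInput 0 1 = toℕ s
  natInput 0 2 = toℕ t
  natInput 1 i = rowMajor 0 (λ u v → bit (adj u v)) i
  natInput 2 i = rowMajor 0 w i
  natInput _ _ = 0

  ratInput : ℕ → ℕ → ℚ
  ratInput 0 0 = β
  ratInput 0 1 = W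
  ratInput 1 i = rowMajor 0ℚ p i
  ratInput _ _ = 0ℚ

output : Store → ℚ
output σ = rat σ 0 0

-- ⌊ W · d ⌋ for W ≥ 0.
⌊_·_⌋ : ℚ → ℕ → ℕ
⌊ W · d ⌋ = ∣ floor (W ℚ.* d /1) ∣

{-# OPTIONS --safe #-}

-- Divided by d = d(s,t), a cost is at most W exactly when the cost is at most
-- N = ⌊W·d⌋.  Acyclicity supplies an order of the vertices in which every arc
-- leads to an earlier vertex; n scans of the adjacency matrix find it in O(n³)
-- steps.  Along this order one computes first d (O(n²) steps), then N by counting
-- up (O(N) steps), and finally, for every vertex u and every budget b ≤ N, the
-- total probability of the u-t paths of cost at most b, each from the entries
-- (v , b − w(u,v)) of the heads v of the arcs leaving u, in O(n) steps.

module Submission where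

open import Defs
open import Data.Bool.Base using (true; false; T)
open import Data.Fin.Base using (Fin; zero; suc; toℕ; fromℕ<; combine; remQuot)
open import Data.Fin.Induction using (spo-noetherian)
import Data.Fin.Properties as Fin
open import Data.Integer.Base as ℤ using (+_; -[1+_]; ∣_∣)
import Data.Integer.Properties as ℤ
open import Data.List.Base using (List; []; _∷_; _++_; map; filter; concat; tabulate; allFin)
open import Data.List.Properties using (filter-≐; filter-++; filter-accept; filter-reject; map-++; map-cong; map-tabulate)
open import Data.Nat.Base as ℕ using (ℕ; zero; suc; _+_; _*_; _∸_; _^_; _≤_; _<_; z≤n; s≤s; NonZero)
open import Data.Nat.Coprimality as Coprime using (1-coprimeTo)
open import Data.Nat.DivMod using (m/n*n≤m; m*n/n≡m; /-monoˡ-≤)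
open import Data.Nat.Properties
open import Data.Nat.Solver using (module +-*-Solver)
open import Data.Product.Base using (∃-syntax; _×_; _,_; proj₁; proj₂)
open import Data.Rational.Base as ℚ using (ℚ; 0ℚ; floor; mkℚ) renaming (_≤_ to _≤ℚ_)
import Data.Rational.Properties as ℚ
import Data.Rational.Unnormalised.Base as ℚᵘ
import Data.Rational.Unnormalised.Properties as ℚᵘ
open import Data.Sum.Base using (_⊎_; inj₁; inj₂)
open import Data.Unit.Base using (⊤; tt)
open import Function.Base using (_∘_; flip)
open import Induction.WellFounded using (WellFounded; Acc; acc)
open import Relation.Binary.Construct.Closure.ReflexiveTransitive using (ε; _◅_)
open import Relation.Binary.Construct.Closure.Transitive as Plus using (TransClosure; [_])
open import Relation.Binary.Definitions using (tri<; tri≈; tri>)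
open import Relation.Binary.PropositionalEquality
open import Relation.Nullary using (¬_; Dec; yes; no; does; Reflects; ofʸ; ofⁿ)
open import Relation.Nullary.Decidable using (T?; _×-dec_; ¬?)
open import Relation.Nullary.Negation using (contradiction)
open import Relation.Nullary.Reflects using (fromEquivalence; ¬-reflects; _×-reflects_)

-- Timed Hoare logic

-- Arcs may cost 0, so the entry for `(u , b)` can depend on entries with the same budget `b`.
-- Increasing budgets alone therefore do not order the computation; it is the order of the vertices
-- that lets every entry read finished ones only. The machine has neither multiplication of natural
-- numbers nor rounding. Row offsets are therefore tabulated by repeated addition, and `N` is
-- reached by comparing successive integers with the rational `W · d`. `Pr` is defined through
-- `paths≤`, a recursion on the number of arcs, whereas the table has no such parameter. The two
-- meet in `F k`, whose value at a vertex no longer changes once `k` exceeds the position of the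
-- vertex in the order.

infixr 4 _≫_

update-same : ∀ {A : Set} (m : ℕ → ℕ → A) a i {x} → update m a i x a i ≡ x
update-same m a i with a ≟ a | i ≟ i
... | yes _   | yes _   = refl
... | no  a≢a | _       = contradiction refl a≢a
... | yes _   | no  i≢i = contradiction refl i≢i

update-other : ∀ {A : Set} {m : ℕ → ℕ → A} a {i j x} → i ≢ j → update m a i x a j ≡ m a j
update-other a {i} {j} i≢j with a ≟ a | i ≟ j
... | yes _ | yes i≡j = contradiction i≡j i≢j
... | no  _ | yes _   = refl
... | yes _ | no  _   = refl
... | no  _ | no  _   = refl

-- Total correctness under a budget. `k` only bounds the number of steps, so that the two branches
-- of a conditional, which may differ in cost, fit under one budget.
record Exec (c : Program) (σ : Store) (k : ℕ) (Q : Store → Set) : Set where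
  constructor exec
  field
    {final} : Store
    {steps} : ℕ
    run     : ⟨ c , σ ⟩⇓⟨ final , steps ⟩
    bound   : steps ≤ k
    post    : Q final

conseq : ∀ {c σ k Q R} → (∀ {τ} → Q τ → R τ) → Exec c σ k Q → Exec c σ k R
conseq f (exec r b q) = exec r b (f q)

done : ∀ {σ Q} → Q σ → Exec skip σ 1 Q
done q = exec ⇓skip ≤-refl q

assignᴺ : ∀ {a i e σ Q} →
  Q (store (update (nat σ) a (evalᴺ i σ) (evalᴺ e σ)) (rat σ)) →
  Exec (a [ i ]≔ᴺ e) σ (1 + stepsᴺ i + stepsᴺ e) Q
assignᴺ q = exec ⇓assignᴺ ≤-refl q

assignᴿ : ∀ {a i e σ Q} →
  Q (store (nat σ) (update (rat σ) a (evalᴺ i σ) (evalᴿ e σ))) →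
  Exec (a [ i ]≔ᴿ e) σ (1 + stepsᴺ i + stepsᴿ e) Q
assignᴿ q = exec ⇓assignᴿ ≤-refl q

_≫_ : ∀ {c d σ k l R Q} →
  Exec c σ k R → (∀ {τ} → R τ → Exec d τ l Q) → Exec (c ⨾ d) σ (k + l) Q
exec r b q ≫ f with exec r′ b′ q′ ← f q = exec (⇓seq r r′) (+-mono-≤ b b′) q′

⟦_⟧ : BExp → Store → Set
⟦ e ≤ᴺ f ⟧  σ = evalᴺ e σ ≤ evalᴺ f σ
⟦ e ≤ᴿ f ⟧  σ = evalᴿ e σ ≤ℚ evalᴿ f σ
⟦ neg b ⟧   σ = ¬ ⟦ b ⟧ σ
⟦ b and c ⟧ σ = ⟦ b ⟧ σ × ⟦ c ⟧ σ

evalᴮ-reflects : ∀ b σ → Reflects (⟦ b ⟧ σ) (evalᴮ b σ)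
evalᴮ-reflects (e ≤ᴺ f)  σ = fromEquivalence (≤ᵇ⇒≤ _ _) ≤⇒≤ᵇ
evalᴮ-reflects (e ≤ᴿ f)  σ = fromEquivalence ℚ.≤ᵇ⇒≤ ℚ.≤⇒≤ᵇ
evalᴮ-reflects (neg b)   σ = ¬-reflects (evalᴮ-reflects b σ)
evalᴮ-reflects (b and c) σ = evalᴮ-reflects b σ ×-reflects evalᴮ-reflects c σ

branch : ∀ {b c d σ k l Q} →
  (⟦ b ⟧ σ → Exec c σ k Q) → (¬ ⟦ b ⟧ σ → Exec d σ l Q) →
  Exec (if b then c else d) σ (1 + stepsᴮ b + (k + l)) Q
branch {b} {σ = σ} {k} {l} f g with evalᴮ b σ in eq | evalᴮ-reflects b σ
... | true  | ofʸ p with exec r h q ← f p =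
  exec (⇓then eq r) (+-monoʳ-≤ (1 + stepsᴮ b) (≤-trans h (m≤m+n k l))) q
... | false | ofⁿ ¬p with exec r h q ← g ¬p =
  exec (⇓else eq r) (+-monoʳ-≤ (1 + stepsᴮ b) (≤-trans h (m≤n+m l k))) q

whileCost : ℕ → ℕ → ℕ → ℕ
whileCost test m k = m * (test + k) + test

-- `I i` describes the store after `i` iterations. The test has to be equivalent to `i < N`: one
-- direction excludes a further iteration, the other an early exit. The induction is on the
-- iterations left, `m` with `m + i ≡ N`.
while-rule : ∀ {b c k N σ} (I : ℕ → Store → Set) →
  (∀ {i σ} → I i σ → (⟦ b ⟧ σ → i < N) × (i < N → ⟦ b ⟧ σ)) →
  (∀ {i σ} → i < N → I i σ → Exec c σ k (I (suc i))) →
  I 0 σ → Exec (while b loop c) σ (whileCost (1 + stepsᴮ b) N k) (I N)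
while-rule {b} {c} {k} {N} I test step = from N (+-identityʳ N)
  where
  from : ∀ m {i σ} → m + i ≡ N → I i σ →
         Exec (while b loop c) σ (whileCost (1 + stepsᴮ b) m k) (I N)
  from m {i} {σ} eq p with evalᴮ b σ in b≡ | evalᴮ-reflects b σ
  from zero    refl p | true  | ofʸ h = contradiction (proj₁ (test p) h) (<-irrefl refl)
  from zero    refl p | false | _     = exec (⇓exit b≡) ≤-refl p
  from (suc m) {i} eq p | false | ofⁿ ¬h =
    contradiction (proj₂ (test p) (subst (i <_) eq (s≤s (m≤n+m i m)))) ¬h
  from (suc m) {i} eq p | true  | ofʸ h
    with exec r h₁ q ← step (proj₁ (test p) h) p
    with exec r′ h₂ q′ ← from m (trans (+-suc m i) eq) q =
      exec (⇓iterate b≡ r r′)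
        (≤-trans (+-mono-≤ (+-monoʳ-≤ (1 + stepsᴮ b) h₁) h₂)
                 (≤-reflexive (sym (+-assoc (1 + stepsᴮ b + k) _ _))))
        q′

for_upTo_loop_ : ℕ → NExp → Program → Program
for a upTo e loop c =
  a [ lit 0 ]≔ᴺ lit 0 ⨾
  while (a [ lit 0 ]ᴺ ⊕ lit 1 ≤ᴺ e) loop
    (c ⨾ a [ lit 0 ]≔ᴺ a [ lit 0 ]ᴺ ⊕ lit 1)

set : ℕ → ℕ → Store → Store
set a x σ = store (update (nat σ) a 0 x) (rat σ)

-- `3` pays for the reset of the counter, `6 + e` for a test whose limit costs `e`, and the `6`
-- after `k` for the increment.
forCost : ℕ → ℕ → ℕ → ℕ
forCost e N k = 3 + whileCost (6 + e) N (k + 6)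

-- The body must establish the invariant in the store after the increment. The invariants used below
-- never mention their own counter, so `set` computes away in them.
for-rule : ∀ {a e c k N σ} (I : ℕ → Store → Set) →
  (∀ {i σ} → I i σ → evalᴺ e σ ≡ N) →
  (∀ {i σ} → i < N → nat σ a 0 ≡ i → I i σ →
    Exec c σ k (λ τ → nat τ a 0 ≡ i × I (suc i) (set a (nat τ a 0 + 1) τ))) →
  I 0 (set a 0 σ) →
  Exec (for a upTo e loop c) σ (forCost (stepsᴺ e) N k) (I N)
for-rule {a} {e} {c} {k} {N} I limit body p =
  assignᴺ (update-same _ a 0 , p) ≫ λ q →
  conseq proj₂ (while-rule K test step q)
  where
  K : ℕ → Store → Set
  K i σ = nat σ a 0 ≡ i × I i σ

  test : ∀ {i σ} → K i σ → (nat σ a 0 + 1 ≤ evalᴺ e σ → i < N) × (i < N → nat σ a 0 + 1 ≤ evalᴺ e σ)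
  test {i} (refl , q) rewrite limit q | +-comm i 1 = (λ h → h) , (λ h → h)

  step : ∀ {i σ} → i < N → K i σ →
    Exec (c ⨾ a [ lit 0 ]≔ᴺ a [ lit 0 ]ᴺ ⊕ lit 1) σ (k + 6) (K (suc i))
  step {i} i<N (eq , q) = body i<N eq q ≫ λ (eq′ , q′) →
    assignᴺ (trans (update-same _ a 0) (trans (cong (_+ 1) eq′) (+-comm i 1)) , q′)

for-Fin : ∀ {a e c k n σ} (I : ℕ → Store → Set) →
  (∀ {i σ} → I i σ → evalᴺ e σ ≡ n) →
  (∀ (v : Fin n) {σ} → nat σ a 0 ≡ toℕ v → I (toℕ v) σ →
    Exec c σ k (λ τ → nat τ a 0 ≡ toℕ v × I (suc (toℕ v)) (set a (nat τ a 0 + 1) τ))) →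
  I 0 (set a 0 σ) →
  Exec (for a upTo e loop c) σ (forCost (stepsᴺ e) n k) (I n)
for-Fin {a} {c = c} {k} I limit body = for-rule I limit λ {_} {σ} i<n →
  subst (λ i → nat σ a 0 ≡ i → I i σ →
           Exec c σ k (λ τ → nat τ a 0 ≡ i × I (suc i) (set a (nat τ a 0 + 1) τ)))
        (Fin.toℕ-fromℕ< i<n) (body (fromℕ< i<n))

infix 4 _≼_·_

-- A record rather than an abbreviation, so that the multiplier and the
-- multiplicand can be inferred.
record _≼_·_ (a K X : ℕ) : Set where
  constructor bounded
  field
    holds : a ≤ K * X

const-bound : ∀ {X} c → 1 ≤ X → c ≼ c · X
const-bound c 1≤X = bounded (≤-trans (≤-reflexive (sym (*-identityʳ c))) (*-monoʳ-≤ c 1≤X))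

+-bound : ∀ {a b K L X} → a ≼ K · X → b ≼ L · X → a + b ≼ K + L · X
+-bound {K = K} {L} {X} (bounded a≤) (bounded b≤) =
  bounded (≤-trans (+-mono-≤ a≤ b≤) (≤-reflexive (sym (*-distribʳ-+ X K L))))

scale : ∀ {a K X Y} → X ≤ Y → a ≼ K · X → a ≼ K · Y
scale {K = K} X≤Y (bounded a≤) = bounded (≤-trans a≤ (*-monoʳ-≤ K X≤Y))

-- Tests and increments contribute `(12 + e) * N`, the reset and the last test `9 + e`. As `N` and
-- `Y` are positive, both are absorbed into multiples of `N * Y`, which gives `21 + (e + e)` on top
-- of the constant of the body.
forCost-bound : ∀ e {N k K Y} → 1 ≤ N → 1 ≤ Y → k ≼ K · Y →
  forCost e N k ≼ 21 + (e + e) + K · (N * Y)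
forCost-bound e {N} {k} {K} {Y} 1≤N 1≤Y (bounded k≤KY) = bounded (begin
  forCost e N k
    ≡⟨ solve 3 (λ e N k →
         con 3 :+ (N :* (con 6 :+ e :+ (k :+ con 6)) :+ (con 6 :+ e)) :=
         (con 12 :+ e) :* (N :* con 1) :+ N :* k :+ (con 9 :+ e) :* con 1) refl e N k ⟩
  (12 + e) * (N * 1) + N * k + (9 + e) * 1
    ≤⟨ +-mono-≤ (+-mono-≤ (*-monoʳ-≤ (12 + e) (*-monoʳ-≤ N 1≤Y)) (*-monoʳ-≤ N k≤KY))
                (*-monoʳ-≤ (9 + e) (*-mono-≤ 1≤N 1≤Y)) ⟩
  (12 + e) * (N * Y) + N * (K * Y) + (9 + e) * (N * Y)
    ≡⟨ solve 4 (λ e N K Y →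
         (con 12 :+ e) :* (N :* Y) :+ N :* (K :* Y) :+ (con 9 :+ e) :* (N :* Y) :=
         (con 21 :+ (e :+ e) :+ K) :* (N :* Y)) refl e N K Y ⟩
  (21 + (e + e) + K) * (N * Y) ∎)
  where
  open ≤-Reasoning
  open +-*-Solver

-- Rationals

/1-*-cancel : ∀ c d .{{_ : NonZero d}} → (+ c ℚ./ d) ℚ.* d /1 ≡ c /1
/1-*-cancel c d@(suc d-1) = ℚ.toℚᵘ-injective (begin
  ℚ.toℚᵘ ((+ c ℚ./ d) ℚ.* d /1)
    ≈⟨ ℚ.toℚᵘ-homo-* (+ c ℚ./ d) (d /1) ⟩
  ℚ.toℚᵘ (+ c ℚ./ d) ℚᵘ.* ℚ.toℚᵘ (d /1)
    ≈⟨ ℚᵘ.*-cong (ℚ.toℚᵘ-fromℚᵘ (ℚᵘ.mkℚᵘ (+ c) d-1)) (ℚ.toℚᵘ-fromℚᵘ (ℚᵘ.mkℚᵘ (+ d) 0)) ⟩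
  ℚᵘ.mkℚᵘ (+ c) d-1 ℚᵘ.* ℚᵘ.mkℚᵘ (+ d) 0
    ≈⟨ ℚᵘ.*≡* (trans (ℤ.*-identityʳ (+ c ℤ.* + d)) (cong (λ x → + c ℤ.* + x) (sym (*-identityʳ d)))) ⟩
  ℚᵘ.mkℚᵘ (+ c) 0
    ≈⟨ ℚ.toℚᵘ-fromℚᵘ (ℚᵘ.mkℚᵘ (+ c) 0) ⟨
  ℚ.toℚᵘ (c /1) ∎)
  where open ℚᵘ.≃-Reasoning

/1-normal : ∀ m → m /1 ≡ mkℚ (+ m) 0 (Coprime.sym (1-coprimeTo m))
/1-normal m = ℚ.normalize-coprime (Coprime.sym (1-coprimeTo m))

-- The Galois connection between the embedding of the integers and the floor. It serves twice: to
-- replace `W` by an integer bound on costs, and to show that the loop of `threshold` stops exactly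
-- at the floor.
floor-adjoint : ∀ j q → 0ℚ ≤ℚ q →
  (j ≤ ∣ floor q ∣ → j /1 ≤ℚ q) × (j /1 ≤ℚ q → j ≤ ∣ floor q ∣)
floor-adjoint j (mkℚ -[1+ a ] b _) (ℚ.*≤* ())
floor-adjoint j (mkℚ (+ a) b _) _
  rewrite /1-normal j | ℤ.*-identityˡ (+ (a ℕ./ suc b)) = to , from
  where
  open ≤-Reasoning

  to : j ≤ a ℕ./ suc b → _
  to j≤ = ℚ.*≤* (subst₂ ℤ._≤_ (ℤ.pos-* j (suc b)) (sym (ℤ.*-identityʳ (+ a)))
    (ℤ.+≤+ (≤-trans (*-monoˡ-≤ (suc b) j≤) (m/n*n≤m a (suc b)))))

  from : _ → j ≤ a ℕ./ suc b
  from (ℚ.*≤* h) = begin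
    j                   ≡⟨ m*n/n≡m j (suc b) ⟨
    j * suc b ℕ./ suc b ≤⟨ /-monoˡ-≤ (suc b) (ℤ.drop‿+≤+
      (subst₂ ℤ._≤_ (sym (ℤ.pos-* j (suc b))) (ℤ.*-identityʳ (+ a)) h)) ⟩
    a ℕ./ suc b         ∎

·-nonNeg : ∀ W d → 0ℚ ≤ℚ W → 0ℚ ≤ℚ W ℚ.* d /1
·-nonNeg W d 0≤W = subst (_≤ℚ W ℚ.* d /1) (ℚ.*-zeroˡ (d /1))
  (ℚ.*-monoʳ-≤-nonNeg (d /1) {{ℚ.normalize-nonNeg d 1}} 0≤W)

cost-threshold : ∀ c d .{{_ : NonZero d}} W → 0ℚ ≤ℚ W →
  (c ≤ ⌊ W · d ⌋ → + c ℚ./ d ≤ℚ W) × (+ c ℚ./ d ≤ℚ W → c ≤ ⌊ W · d ⌋)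
cost-threshold c d@(suc _) W 0≤W =
    (λ c≤ → ℚ.*-cancelʳ-≤-pos (d /1)
       (subst (_≤ℚ W ℚ.* d /1) (sym (/1-*-cancel c d)) (proj₁ adj c≤)))
  , (λ c/d≤ → proj₂ adj
       (subst (_≤ℚ W ℚ.* d /1) (/1-*-cancel c d) (ℚ.*-monoʳ-≤-nonNeg (d /1) c/d≤)))
  where
  instance
    d>0 : ℚ.Positive (d /1)
    d>0 = ℚ.normalize-pos d 1

    d≥0 : ℚ.NonNegative (d /1)
    d≥0 = ℚ.pos⇒nonNeg (d /1)

  adj = floor-adjoint c (W ℚ.* d /1) (·-nonNeg W d 0≤W)

-- Row-major indices

rowMajor-lookup : ∀ {A : Set} {n} {default : A} f (u v : Fin n) →
  rowMajor default f (toℕ u * n + toℕ v) ≡ f u v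
rowMajor-lookup {n = n} f u v with toℕ u * n + toℕ v <? n * n
... | yes h = cong (λ (x , y) → f x y) (begin
  remQuot n (fromℕ< h)    ≡⟨ cong (remQuot n) (Fin.toℕ-injective index) ⟩
  remQuot n (combine u v) ≡⟨ Fin.remQuot-combine u v ⟩
  (u , v)                 ∎)
  where
  open ≡-Reasoning
  index : toℕ (fromℕ< h) ≡ toℕ (combine u v)
  index = trans (Fin.toℕ-fromℕ< h)
    (sym (trans (Fin.toℕ-combine u v) (cong (_+ toℕ v) (*-comm n (toℕ u)))))
... | no ¬h = contradiction
  (subst (_< n * n) (trans (Fin.toℕ-combine u v) (cong (_+ toℕ v) (*-comm n (toℕ u))))
    (Fin.toℕ<n (combine u v))) ¬h

row-< : ∀ {n a b} (u v : Fin n) → a < b → a * n + toℕ u < b * n + toℕ v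
row-< {n} {a} {b} u v a<b = begin-strict
  a * n + toℕ u <⟨ +-monoʳ-< (a * n) (Fin.toℕ<n u) ⟩
  a * n + n     ≡⟨ +-comm (a * n) n ⟩
  suc a * n     ≤⟨ *-monoˡ-≤ n a<b ⟩
  b * n         ≤⟨ m≤m+n (b * n) (toℕ v) ⟩
  b * n + toℕ v ∎
  where open ≤-Reasoning

-- Uniqueness of division with remainder. The rows are arbitrary numbers because in the table they
-- are budgets; the lemma shows that writing one entry leaves the others intact.
row-injective : ∀ {n} a b (u v : Fin n) → a * n + toℕ u ≡ b * n + toℕ v → a ≡ b × u ≡ v
row-injective {n} a b u v eq with <-cmp a b
... | tri< a<b _ _  = contradiction eq (<⇒≢ (row-< u v a<b))
... | tri> _ _ b<a  = contradiction (sym eq) (<⇒≢ (row-< v u b<a))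
... | tri≈ _ refl _ = refl , Fin.toℕ-injective (+-cancelˡ-≡ (a * n) _ _ eq)

-- Paths

-- The bound is a plain number, so that it can follow a loop counter up to and including `n`.
prefixSum : ∀ {n} → (Fin n → ℚ) → ℕ → ℚ
prefixSum {zero}  f j       = 0ℚ
prefixSum {suc n} f zero    = 0ℚ
prefixSum {suc n} f (suc j) = f zero ℚ.+ prefixSum (f ∘ suc) j

prefixSum-zero : ∀ {n} (f : Fin n → ℚ) → prefixSum f 0 ≡ 0ℚ
prefixSum-zero {zero}  f = refl
prefixSum-zero {suc n} f = refl

prefixSum-suc : ∀ {n} (f : Fin n → ℚ) i → prefixSum f (suc (toℕ i)) ≡ prefixSum f (toℕ i) ℚ.+ f i
prefixSum-suc f zero    = trans (cong (f zero ℚ.+_) (prefixSum-zero (f ∘ suc))) (ℚ.+-comm (f zero) 0ℚ)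
prefixSum-suc f (suc i) =
  trans (cong (f zero ℚ.+_) (prefixSum-suc (f ∘ suc) i)) (sym (ℚ.+-assoc (f zero) _ _))

prefixSum-all : ∀ {n} (f : Fin n → ℚ) → prefixSum f n ≡ sumℚ (tabulate f)
prefixSum-all {zero}  f = refl
prefixSum-all {suc n} f = cong (f zero ℚ.+_) (prefixSum-all (f ∘ suc))

sumℚ-++ : ∀ xs ys → sumℚ (xs ++ ys) ≡ sumℚ xs ℚ.+ sumℚ ys
sumℚ-++ []       ys = sym (ℚ.+-identityˡ (sumℚ ys))
sumℚ-++ (x ∷ xs) ys = trans (cong (x ℚ.+_) (sumℚ-++ xs ys)) (sym (ℚ.+-assoc x _ _))

-- The subtrahend is the absolute difference of `i` and `j`. The formula uses only machine
-- operations, so that `#kronecker` evaluates to it; it gives the starting values of both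
-- recursions, for distances and for probabilities.
kronecker : ℕ → ℕ → ℕ
kronecker i j = 1 ∸ ((i ∸ j) + (j ∸ i))

kronecker-same : ∀ i → kronecker i i ≡ 1
kronecker-same i rewrite n∸n≡0 i = refl

kronecker-distinct : ∀ {i j} → i ≢ j → kronecker i j ≡ 0
kronecker-distinct {i} {j} i≢j with i ∸ j in eq₁ | j ∸ i in eq₂
... | suc k | l     = 0∸n≡0 (k + l)
... | zero  | suc l = 0∸n≡0 l
... | zero  | zero  = contradiction (≤-antisym (m∸n≡0⇒m≤n eq₁) (m∸n≡0⇒m≤n eq₂)) i≢j

module PathSums {n : ℕ} (M : Model n) where
  open Model M

  weight : ∀ {u} → ℕ → List (Path u t) → ℚ
  weight b Ps = sumℚ (map prob (filter (λ P → cost P ≤? b) Ps))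

  weight-++ : ∀ {u} b (Ps Qs : List (Path u t)) → weight b (Ps ++ Qs) ≡ weight b Ps ℚ.+ weight b Qs
  weight-++ b Ps Qs = begin
    weight b (Ps ++ Qs)
      ≡⟨ cong (sumℚ ∘ map prob) (filter-++ (λ P → cost P ≤? b) Ps Qs) ⟩
    sumℚ (map prob (filter _ Ps ++ filter _ Qs))
      ≡⟨ cong sumℚ (map-++ prob (filter _ Ps) (filter _ Qs)) ⟩
    sumℚ (map prob (filter _ Ps) ++ map prob (filter _ Qs))
      ≡⟨ sumℚ-++ (map prob (filter _ Ps)) _ ⟩
    weight b Ps ℚ.+ weight b Qs ∎
    where open ≡-Reasoning

  weight-concat : ∀ {A : Set} {u} b (f : A → List (Path u t)) xs →
    weight b (concat (map f xs)) ≡ sumℚ (map (weight b ∘ f) xs)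
  weight-concat b f []       = refl
  weight-concat b f (x ∷ xs) =
    trans (weight-++ b (f x) _) (cong (weight b (f x) ℚ.+_) (weight-concat b f xs))

  weight-accept : ∀ {u b} (P : Path u t) Ps → cost P ≤ b →
    weight b (P ∷ Ps) ≡ prob P ℚ.+ weight b Ps
  weight-accept {b = b} P Ps h =
    cong (sumℚ ∘ map prob) (filter-accept (λ P → cost P ≤? b) {P} {Ps} h)

  weight-reject : ∀ {u b} (P : Path u t) Ps → ¬ cost P ≤ b → weight b (P ∷ Ps) ≡ weight b Ps
  weight-reject {b = b} P Ps ¬h =
    cong (sumℚ ∘ map prob) (filter-reject (λ P → cost P ≤? b) {P} {Ps} ¬h)

  -- The first arc contributes the factor `p u x` and uses up `w u x` of the budget. Dear arcs are
  -- treated separately because truncated subtraction would leave them the budget 0 and so admit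
  -- tails of cost 0.
  weight-◅-cheap : ∀ {u x} b (a : Arc u x) Ps → w u x ≤ b →
    weight b (map (a ◅_) Ps) ≡ p u x ℚ.* weight (b ∸ w u x) Ps
  weight-◅-cheap {u} {x} b a [] w≤b = sym (ℚ.*-zeroʳ (p u x))
  weight-◅-cheap {u} {x} b a (P ∷ Ps) w≤b with cost P ≤? b ∸ w u x
  ... | yes h = begin
    weight b (map (a ◅_) (P ∷ Ps))
      ≡⟨ weight-accept (a ◅ P) _ (subst (w u x + cost P ≤_) (m+[n∸m]≡n w≤b) (+-monoʳ-≤ (w u x) h)) ⟩
    p u x ℚ.* prob P ℚ.+ weight b (map (a ◅_) Ps)
      ≡⟨ cong (p u x ℚ.* prob P ℚ.+_) (weight-◅-cheap b a Ps w≤b) ⟩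
    p u x ℚ.* prob P ℚ.+ p u x ℚ.* weight (b ∸ w u x) Ps
      ≡⟨ ℚ.*-distribˡ-+ (p u x) (prob P) _ ⟨
    p u x ℚ.* (prob P ℚ.+ weight (b ∸ w u x) Ps)
      ≡⟨ cong (p u x ℚ.*_) (weight-accept P Ps h) ⟨
    p u x ℚ.* weight (b ∸ w u x) (P ∷ Ps) ∎
    where open ≡-Reasoning
  ... | no ¬h = begin
    weight b (map (a ◅_) (P ∷ Ps))
      ≡⟨ weight-reject (a ◅ P) _
           (¬h ∘ m+n≤o⇒m≤o∸n (cost P) ∘ subst (_≤ b) (+-comm (w u x) (cost P))) ⟩
    weight b (map (a ◅_) Ps)
      ≡⟨ weight-◅-cheap b a Ps w≤b ⟩
    p u x ℚ.* weight (b ∸ w u x) Ps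
      ≡⟨ cong (p u x ℚ.*_) (weight-reject P Ps ¬h) ⟨
    p u x ℚ.* weight (b ∸ w u x) (P ∷ Ps) ∎
    where open ≡-Reasoning

  weight-◅-dear : ∀ {u x} b (a : Arc u x) Ps → ¬ w u x ≤ b → weight b (map (a ◅_) Ps) ≡ 0ℚ
  weight-◅-dear b a []       w≰b = refl
  weight-◅-dear {u} {x} b a (P ∷ Ps) w≰b = trans
    (weight-reject (a ◅ P) _ (w≰b ∘ m+n≤o⇒m≤o (w u x)))
    (weight-◅-dear b a Ps w≰b)

  F : ℕ → Fin n → ℕ → ℚ
  F k u b = weight b (paths≤ k u t)

  arcTerm : (Fin n → ℕ → ℚ) → Fin n → ℕ → Fin n → ℚ
  arcTerm f u b x with T? (adj u x) | w u x ≤? b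
  ... | yes _ | yes _ = p u x ℚ.* f x (b ∸ w u x)
  ... | _     | _     = 0ℚ

  arcTerm-yes : ∀ f {u b x} → Arc u x → w u x ≤ b → arcTerm f u b x ≡ p u x ℚ.* f x (b ∸ w u x)
  arcTerm-yes f {u} {b} {x} a w≤b with T? (adj u x) | w u x ≤? b
  ... | yes _ | yes _   = refl
  ... | yes _ | no  w≰b = contradiction w≤b w≰b
  ... | no ¬a | _       = contradiction a ¬a

  arcTerm-no : ∀ f {u b x} → ¬ (Arc u x × w u x ≤ b) → arcTerm f u b x ≡ 0ℚ
  arcTerm-no f {u} {b} {x} ¬h with T? (adj u x) | w u x ≤? b
  ... | yes a | yes w≤b = contradiction (a , w≤b) ¬h
  ... | yes _ | no  _   = refl
  ... | no  _ | yes _   = refl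
  ... | no  _ | no  _   = refl

  weight-via : ∀ k u b x → weight b (paths≤via k u t x) ≡ arcTerm (F k) u b x
  weight-via k u b x with T? (adj u x) | w u x ≤? b
  ... | yes a | yes w≤b = weight-◅-cheap b a (paths≤ k x t) w≤b
  ... | yes a | no  w≰b = weight-◅-dear b a (paths≤ k x t) w≰b
  ... | no  _ | yes _   = refl
  ... | no  _ | no  _   = refl

  weight-trivial : ∀ u b → weight b (trivial u t) ≡ kronecker (toℕ u) (toℕ t) /1
  weight-trivial u b with u Fin.≟ t
  ... | yes refl = sym (cong _/1 (kronecker-same (toℕ u)))
  ... | no  u≢t  = sym (cong _/1 (kronecker-distinct (u≢t ∘ Fin.toℕ-injective)))

  -- Paths are split by their first arc; the Kronecker term is the empty path, which fits every
  -- budget. The equation has the same form at `t`, since the enumeration also tries the arcs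
  -- leaving `t`.
  F-suc : ∀ k u b →
    F (suc k) u b ≡ kronecker (toℕ u) (toℕ t) /1 ℚ.+ prefixSum (arcTerm (F k) u b) n
  F-suc k u b = begin
    F (suc k) u b
      ≡⟨ weight-++ b (trivial u t) _ ⟩
    weight b (trivial u t) ℚ.+ weight b (concat (map (paths≤via k u t) (allFin n)))
      ≡⟨ cong₂ ℚ._+_ (weight-trivial u b) (weight-concat b (paths≤via k u t) (allFin n)) ⟩
    δ ℚ.+ sumℚ (map (weight b ∘ paths≤via k u t) (allFin n))
      ≡⟨ cong (λ xs → δ ℚ.+ sumℚ xs) (map-cong (weight-via k u b) (allFin n)) ⟩
    δ ℚ.+ sumℚ (map (arcTerm (F k) u b) (allFin n))
      ≡⟨ cong (λ xs → δ ℚ.+ sumℚ xs) (map-tabulate (λ x → x) (arcTerm (F k) u b)) ⟩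
    δ ℚ.+ sumℚ (tabulate (arcTerm (F k) u b))
      ≡⟨ cong (δ ℚ.+_) (prefixSum-all (arcTerm (F k) u b)) ⟨
    δ ℚ.+ prefixSum (arcTerm (F k) u b) n ∎
    where
    open ≡-Reasoning
    δ = kronecker (toℕ u) (toℕ t) /1

  Pr≡F : ∀ d .{{_ : NonZero d}} W → 0ℚ ≤ℚ W → Pr[X d ≤ W ] ≡ F n s ⌊ W · d ⌋
  Pr≡F d W 0≤W = cong (sumℚ ∘ map prob) (filter-≐ _ _
    ((λ {P} → proj₂ (cost-threshold (cost P) d W 0≤W)) , (λ {P} → proj₁ (cost-threshold (cost P) d W 0≤W)))
    (paths s t))

-- Reverse topological orders

module Orders {n : ℕ} (G : DAG n) where
  open DAG G

  -- Acyclicity makes the transitive closure of the arcs a strict partial order, and on a finite set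
  -- such an order has no infinite ascending chain.
  noetherian : WellFounded (flip (TransClosure Arc))
  noetherian = spo-noetherian record
    { isEquivalence = isEquivalence
    ; irrefl        = λ { refl → acyclic _ }
    ; trans         = Plus._++_
    ; <-resp-≈      = resp₂ (TransClosure Arc)
    }

  -- Follow arcs that stay inside `P` until there is none. Applied to the unlisted vertices, this
  -- yields one whose heads are all listed: a candidate for the next entry of the order.
  maximal : {P : Fin n → Set} → (∀ v → Dec (P v)) → ∀ u → P u →
    ∃[ x ] P x × (∀ y → Arc x y → ¬ P y)
  maximal {P} P? u = go u (noetherian u)
    where
    go : ∀ u → Acc (flip (TransClosure Arc)) u → P u → ∃[ x ] P x × (∀ y → Arc x y → ¬ P y)
    go u (acc rec) pu with Fin.any? (λ y → T? (adj u y) ×-dec P? y)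
    ... | yes (y , a , py) = go y (rec [ a ]) py
    ... | no  none         = u , pu , λ y a py → none (y , a , py)

  Listed : (ℕ → Fin n) → ℕ → Fin n → Set
  Listed o k v = ∃[ j ] j < k × o j ≡ v

  listed? : ∀ o k v → Dec (Listed o k v)
  listed? o k v = anyUpTo? (λ j → o j Fin.≟ v) k

  -- Only the first `k` entries are constrained; the rest of `o` is arbitrary, so the order can grow
  -- entry by entry.
  record Topological (o : ℕ → Fin n) (k : ℕ) : Set where
    field
      arcs     : ∀ {i v} → i < k → Arc (o i) v → Listed o i v
      distinct : ∀ {i j} → i < j → j < k → o i ≢ o j

    injective : ∀ {i j} → i < k → j < k → o i ≡ o j → i ≡ j
    injective {i} {j} i<k j<k eq with <-cmp i j
    ... | tri< i<j _ _ = contradiction eq (distinct i<j j<k)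
    ... | tri≈ _ i≡j _ = i≡j
    ... | tri> _ _ j<i = contradiction (sym eq) (distinct j<i i<k)

  open Topological

  -- Otherwise, sending each vertex to its position would be an injection from `n` vertices into `k`
  -- positions.
  some-unlisted : ∀ o k → k < n → ∃[ v ] ¬ Listed o k v
  some-unlisted o k k<n = Fin.¬∀⟶∃¬ n _ (listed? o k) λ all → contradiction
    (Fin.injective⇒≤ {f = λ v → fromℕ< (proj₁ (proj₂ (all v)))} λ {u} {v} eq →
      trans (sym (proj₂ (proj₂ (all u))))
        (trans (cong o (Fin.fromℕ<-injective _ _ _ _ eq)) (proj₂ (proj₂ (all v)))))
    (<⇒≱ k<n)

  -- A missing vertex together with the `n` distinct entries would make `n + 1` distinct vertices.
  all-listed : ∀ {o} → Topological o n → ∀ v → Listed o n v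
  all-listed {o} top v with listed? o n v
  ... | yes h = h
  ... | no ¬h = contradiction (Fin.injective⇒≤ {f = f} f-injective) 1+n≰n
    where
    f : Fin (suc n) → Fin n
    f zero    = v
    f (suc j) = o (toℕ j)

    f-injective : ∀ {i j} → f i ≡ f j → i ≡ j
    f-injective {zero}  {zero}  eq = refl
    f-injective {zero}  {suc j} eq = contradiction (toℕ j , Fin.toℕ<n j , sym eq) ¬h
    f-injective {suc i} {zero}  eq = contradiction (toℕ i , Fin.toℕ<n i , eq) ¬h
    f-injective {suc i} {suc j} eq =
      cong suc (Fin.toℕ-injective (injective top (Fin.toℕ<n i) (Fin.toℕ<n j) eq))

  extend : (ℕ → Fin n) → ℕ → Fin n → ℕ → Fin n
  extend o k x j with j ≟ k
  ... | yes _ = x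
  ... | no  _ = o j

  extend-new : ∀ o k x → extend o k x k ≡ x
  extend-new o k x with k ≟ k
  ... | yes _  = refl
  ... | no k≢k = contradiction refl k≢k

  extend-old : ∀ o x {j k} → j < k → extend o k x j ≡ o j
  extend-old o x {j} {k} j<k with j ≟ k
  ... | yes refl = contradiction j<k (<-irrefl refl)
  ... | no  _    = refl

  extend-listed : ∀ {o x i k v} → i ≤ k → Listed o i v → Listed (extend o k x) i v
  extend-listed {o} {x} i≤k (j , j<i , eq) = j , j<i , trans (extend-old o x (<-≤-trans j<i i≤k)) eq

  <-suc-case : ∀ {i k} → i < suc k → i < k ⊎ i ≡ k
  <-suc-case (s≤s i≤k) = m≤n⇒m<n∨m≡n i≤k

  listed-suc : ∀ {o x k v} → Listed (extend o k x) (suc k) v → Listed o k v ⊎ x ≡ v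
  listed-suc {o} {x} {k} (j , j<1+k , eq) with <-suc-case j<1+k
  ... | inj₁ j<k  = inj₁ (j , j<k , trans (sym (extend-old o x j<k)) eq)
  ... | inj₂ refl = inj₂ (trans (sym (extend-new o k x)) eq)

  topological-zero : ∀ o → Topological o 0
  topological-zero o = record { arcs = λ () ; distinct = λ _ () }

  topological-extend : ∀ {o k x} → Topological o k → ¬ Listed o k x →
    (∀ v → Arc x v → Listed o k v) → Topological (extend o k x) (suc k)
  topological-extend {o} {k} {x} top new ready = record { arcs = arcs′ ; distinct = distinct′ }
    where
    arcs′ : ∀ {i v} → i < suc k → Arc (extend o k x i) v → Listed (extend o k x) i v
    arcs′ {i} {v} i<1+k a with <-suc-case i<1+k
    ... | inj₁ i<k  = extend-listed (<⇒≤ i<k)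
      (arcs top i<k (subst (λ u → Arc u v) (extend-old o x i<k) a))
    ... | inj₂ refl = extend-listed ≤-refl
      (ready v (subst (λ u → Arc u v) (extend-new o k x) a))

    distinct′ : ∀ {i j} → i < j → j < suc k → extend o k x i ≢ extend o k x j
    distinct′ {i} {j} i<j j<1+k eq with <-suc-case j<1+k
    ... | inj₁ j<k  = distinct top i<j j<k
      (trans (sym (extend-old o x (<-trans i<j j<k))) (trans eq (extend-old o x j<k)))
    ... | inj₂ refl = new (i , i<j ,
      trans (sym (extend-old o x i<j)) (trans eq (extend-new o k x)))

-- Distances

module Distances {n : ℕ} (M : Model n) where
  open Model M

  -- The paths accounted for once the loop over heads has passed those below `j`. The empty path is
  -- included from the outset, since the starting value already covers it.
  Starts : ℕ → ∀ {u} → Path u t → Set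
  Starts j ε                 = ⊤
  Starts j (_◅_ {j = x} _ _) = toℕ x < j

  starts-all : ∀ {u} (P : Path u t) → Starts n P
  starts-all ε                 = _
  starts-all (_◅_ {j = x} _ _) = Fin.toℕ<n x

  -- Distances are stored increased by one, so that 0 stands for infinity.
  Encodes : (∀ {u} → Path u t → Set) → Fin n → ℕ → Set
  Encodes A u e =
    (∀ (P : Path u t) → A P → 1 ≤ e × e ≤ suc (cost P)) × (e ≡ 0 ⊎ ∃[ P ] e ≡ suc (cost {u} {t} P))

  Code : Fin n → ℕ → Set
  Code = Encodes (λ _ → ⊤)

  code-distance : ∀ {u d e} → IsDistance u t d → Code u e → e ≡ suc d
  code-distance ((P , refl) , d≤) (lower , inj₁ refl) = contradiction (proj₁ (lower P _)) λ ()
  code-distance ((P , refl) , d≤) (lower , inj₂ (Q , refl)) =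
    ≤-antisym (proj₂ (lower P _)) (s≤s (d≤ Q))

  code-init : ∀ u → Encodes (Starts 0) u (kronecker (toℕ u) (toℕ t))
  code-init u with u Fin.≟ t
  ... | yes refl rewrite kronecker-same (toℕ t) =
    (λ _ _ → ≤-refl , s≤s z≤n) , inj₂ (ε , refl)
  ... | no u≢t rewrite kronecker-distinct (u≢t ∘ Fin.toℕ-injective) =
    (λ { ε _ → contradiction refl u≢t ; (_ ◅ _) () }) , inj₁ refl

  code-finish : ∀ {u e} → Encodes (Starts n) u e → Code u e
  code-finish (lower , attained) = (λ P _ → lower P (starts-all P)) , attained

  -- The code `f` of the head already contains the added 1, so `w u v + f` is again a code. Here `e`
  -- is either 0, meaning infinity, or larger than the new value, so the paths treated earlier
  -- remain bounded below.
  code-update : ∀ {u v e f} → Arc u v → Code v f → 1 ≤ f → ¬ (1 ≤ e × e ≤ w u v + f) →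
    Encodes (Starts (toℕ v)) u e → Encodes (Starts (suc (toℕ v))) u (w u v + f)
  code-update a (_ , inj₁ refl) () _ _
  code-update {u} {v} {e} {f} a (f-lower , inj₂ (Q , refl)) _ better (lower , _) =
    lower′ , inj₂ (a ◅ Q , +-suc (w u v) (cost Q))
    where
    1≤ : 1 ≤ w u v + f
    1≤ = ≤-trans (s≤s z≤n) (m≤n+m f (w u v))

    below : 1 ≤ e → w u v + f ≤ e
    below 1≤e = <⇒≤ (≰⇒> (λ e≤ → better (1≤e , e≤)))

    lower′ : ∀ (P : Path u t) → Starts (suc (toℕ v)) P → 1 ≤ w u v + f × w u v + f ≤ suc (cost P)
    lower′ ε _ = let 1≤e , e≤ = lower ε _ in 1≤ , ≤-trans (below 1≤e) e≤
    lower′ P@(_◅_ {j = x} b R) (s≤s x≤v) with m≤n⇒m<n∨m≡n x≤v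
    ... | inj₁ x<v = let 1≤e , e≤ = lower P x<v in 1≤ , ≤-trans (below 1≤e) e≤
    ... | inj₂ x≡v with refl ← Fin.toℕ-injective x≡v =
      1≤ , ≤-trans (+-monoʳ-≤ (w u v) (proj₂ (f-lower R _))) (≤-reflexive (+-suc (w u v) (cost R)))

  code-keep : ∀ {u v e f} → (Arc u v → Code v f) → (Arc u v → 1 ≤ f → 1 ≤ e × e ≤ w u v + f) →
    Encodes (Starts (toℕ v)) u e → Encodes (Starts (suc (toℕ v))) u e
  code-keep {u} {v} {e} {f} code minimal (lower , attained) = lower′ , attained
    where
    lower′ : ∀ (P : Path u t) → Starts (suc (toℕ v)) P → 1 ≤ e × e ≤ suc (cost P)
    lower′ ε h = lower ε h
    lower′ P@(_◅_ {j = x} b R) (s≤s x≤v) with m≤n⇒m<n∨m≡n x≤v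
    ... | inj₁ x<v = lower P x<v
    ... | inj₂ x≡v with refl ← Fin.toℕ-injective x≡v =
      let 1≤f , f≤ = proj₁ (code b) R _ ; 1≤e , e≤ = minimal b 1≤f in
      1≤e , ≤-trans e≤ (≤-trans (+-monoʳ-≤ (w u v) f≤) (≤-reflexive (+-suc (w u v) (cost R))))

-- The program

-- Memory layout beyond the input.  Natural arrays: 3 and 7 hold the multiples of
-- n (there is no multiplication), 4 marks the vertices already listed in 5, the
-- vertex order, and 6 holds the encoded distances to t.  Rational arrays: 2 is the
-- table, with entry (b , u) at n * b + u, and 3 an accumulator.  Every scalar has
-- an array of its own, so that assertions not mentioning it are preserved
-- definitionally by an assignment to it.

#n #s #t #i #u #v #x #bad #e #B : NExp
#n = 0 [ lit 0 ]ᴺ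
#s = 0 [ lit 1 ]ᴺ
#t = 0 [ lit 2 ]ᴺ
#i = 10 [ lit 0 ]ᴺ
#u = 11 [ lit 0 ]ᴺ
#v = 12 [ lit 0 ]ᴺ
#x = 13 [ lit 0 ]ᴺ
#bad = 14 [ lit 0 ]ᴺ
#e = 15 [ lit 0 ]ᴺ
#B = 16 [ lit 0 ]ᴺ

#adj #w : NExp → NExp
#adj u = 1 [ 3 [ u ]ᴺ ⊕ #v ]ᴺ
#w   u = 2 [ 3 [ u ]ᴺ ⊕ #v ]ᴺ

#kronecker : NExp
#kronecker = lit 1 ⊖ ((#x ⊖ #t) ⊕ (#t ⊖ #x))

multiples scan sort relax distances : Program
multiples = for 10 upTo #n loop (3 [ #i ⊕ lit 1 ]≔ᴺ #n ⊕ 3 [ #i ]ᴺ)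

scan =
  -- The sum in `#bad` is 0 exactly when `#u` is unmarked and every arc from it has a marked head:
  -- `adj ∸ mark` is 1 precisely for an arc to an unmarked head.
  14 [ lit 0 ]≔ᴺ 4 [ #u ]ᴺ ⨾
  for 12 upTo #n loop (14 [ lit 0 ]≔ᴺ #bad ⊕ (#adj #u ⊖ 4 [ #v ]ᴺ)) ⨾
  if #bad ≤ᴺ lit 0 then 13 [ lit 0 ]≔ᴺ #u else skip

sort = for 10 upTo #n loop
  ( for 11 upTo #n loop scan ⨾
    5 [ #i ]≔ᴺ #x ⨾
    4 [ #x ]≔ᴺ lit 1 )

relax =
  if (lit 1 ≤ᴺ #adj #x) and ((lit 1 ≤ᴺ 6 [ #v ]ᴺ) and
       neg ((lit 1 ≤ᴺ #e) and (#e ≤ᴺ #w #x ⊕ 6 [ #v ]ᴺ)))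
  then 15 [ lit 0 ]≔ᴺ #w #x ⊕ 6 [ #v ]ᴺ
  else skip

distances = for 10 upTo #n loop
  ( 13 [ lit 0 ]≔ᴺ 5 [ #i ]ᴺ ⨾
    15 [ lit 0 ]≔ᴺ #kronecker ⨾
    for 12 upTo #n loop relax ⨾
    6 [ #x ]≔ᴺ #e )

threshold addArc sumArcs table eci : Program
-- `⊖ lit 1` decodes the distance. Row offsets for the budgets are filled in along the way, as their
-- number is only known when the loop stops.
threshold = while (cast (#B ⊕ lit 1) ≤ᴿ 0 [ lit 1 ]ᴿ ⊗ cast (6 [ #s ]ᴺ ⊖ lit 1)) loop
  ( 7 [ #B ⊕ lit 1 ]≔ᴺ #n ⊕ 7 [ #B ]ᴺ ⨾
    16 [ lit 0 ]≔ᴺ #B ⊕ lit 1 )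

addArc =
  if (lit 1 ≤ᴺ #adj #x) and (#w #x ≤ᴺ #u)
  then 3 [ lit 0 ]≔ᴿ 3 [ lit 0 ]ᴿ ⊞ 1 [ 3 [ #x ]ᴺ ⊕ #v ]ᴿ ⊗ 2 [ 7 [ #u ⊖ #w #x ]ᴺ ⊕ #v ]ᴿ
  else skip

sumArcs =
  3 [ lit 0 ]≔ᴿ cast #kronecker ⨾
  for 12 upTo #n loop addArc ⨾
  2 [ 7 [ #u ]ᴺ ⊕ #x ]≔ᴿ 3 [ lit 0 ]ᴿ

table = for 10 upTo #n loop
  ( 13 [ lit 0 ]≔ᴺ 5 [ #i ]ᴺ ⨾
    for 11 upTo (#B ⊕ lit 1) loop sumArcs )

eci = multiples ⨾ sort ⨾ distances ⨾ threshold ⨾ table ⨾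
  0 [ lit 0 ]≔ᴿ 2 [ 7 [ #B ]ᴺ ⊕ #s ]ᴿ

-- Memory layout and row offsets

bit-≤ : ∀ {b} → 1 ≤ bit b → T b
bit-≤ {true} _ = tt

T-bit : ∀ {b} → T b → bit b ≡ 1
T-bit {true} _ = refl

module _ {n : ℕ} (M : Model n) (W : ℚ) where
  open Model M
  open PathSums M
  open Orders G
  open Distances M

  Input : Store → Set
  Input σ =
    nat σ 0 0 ≡ n × nat σ 0 1 ≡ toℕ s × nat σ 0 2 ≡ toℕ t ×
    (∀ u v → nat σ 1 (toℕ u * n + toℕ v) ≡ bit (adj u v)) ×
    (∀ u v → nat σ 2 (toℕ u * n + toℕ v) ≡ w u v) ×
    rat σ 0 1 ≡ W ×
    (∀ u v → rat σ 1 (toℕ u * n + toℕ v) ≡ p u v)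

  input-holds : Input (input M W)
  input-holds = refl , refl , refl , rowMajor-lookup _ , rowMajor-lookup w , refl , rowMajor-lookup p

  Rows : Store → Set
  Rows σ = Input σ × (∀ (u : Fin n) → nat σ 3 (toℕ u) ≡ toℕ u * n)

  -- Initial zeros on which `threshold` relies: the offset of row 0 and the counter of budgets. The
  -- earlier phases only carry them along.
  Fresh : Store → Set
  Fresh σ = nat σ 7 0 ≡ 0 × nat σ 16 0 ≡ 0

  multiples-suc : ∀ {m} a {i k x} → k ≡ i + 1 → x ≡ suc i * n →
    (∀ {j} → j ≤ i → m a j ≡ j * n) → ∀ {j} → j ≤ suc i → update m a k x a j ≡ j * n
  multiples-suc {m} a {i} refl refl mult j≤ with m≤n⇒m<n∨m≡n j≤
  ... | inj₁ (s≤s j≤i) =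
    trans (update-other a (λ eq → <⇒≢ (s≤s j≤i) (trans (sym eq) (+-comm i 1)))) (mult j≤i)
  ... | inj₂ refl rewrite +-comm i 1 = update-same m a (suc i)

  multiples-correct : ∀ {σ} → Input σ → nat σ 3 0 ≡ 0 → (∀ i → nat σ 4 i ≡ 0) → Fresh σ →
    Exec multiples σ (forCost 2 n 11) (λ τ → Rows τ × (∀ i → nat τ 4 i ≡ 0) × Fresh τ)
  multiples-correct {σ} inp row₀ unmarked fr =
    conseq (λ (mult , inp , rest) → (inp , λ u → mult (<⇒≤ (Fin.toℕ<n u))) , rest)
      (for-rule I (λ (_ , (n≡ , _) , _) → n≡) body ((λ { {zero} _ → row₀ }) , inp , unmarked , fr))
    where
    I : ℕ → Store → Set
    I i σ = (∀ {j} → j ≤ i → nat σ 3 j ≡ j * n) × Input σ × (∀ i → nat σ 4 i ≡ 0) × Fresh σ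

    body : ∀ {i σ} → i < n → nat σ 10 0 ≡ i → I i σ →
      Exec (3 [ #i ⊕ lit 1 ]≔ᴺ #n ⊕ 3 [ #i ]ᴺ) σ 11
        (λ τ → nat τ 10 0 ≡ i × I (suc i) (set 10 (nat τ 10 0 + 1) τ))
    body {i} {σ} i<n i≡ (mult , inp , rest) = assignᴺ
      ( i≡
      , (λ {j} → multiples-suc {nat σ} 3 (cong (_+ 1) i≡)
          (cong₂ _+_ (proj₁ inp) (trans (cong (nat σ 3) i≡) (mult ≤-refl))) mult {j})
      , inp , rest )

  cell : ∀ {σ i j} (u v : Fin n) → Rows σ → i ≡ toℕ u → j ≡ toℕ v →
    nat σ 3 i + j ≡ toℕ u * n + toℕ v
  cell u v (_ , row) refl refl = cong (_+ toℕ v) (row u)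

  adj-cell : ∀ {σ i j} (u v : Fin n) → Rows σ → i ≡ toℕ u → j ≡ toℕ v →
    nat σ 1 (nat σ 3 i + j) ≡ bit (adj u v)
  adj-cell {σ} u v rows@((_ , _ , _ , A , _) , _) i≡ j≡ =
    trans (cong (nat σ 1) (cell {σ} u v rows i≡ j≡)) (A u v)

  w-cell : ∀ {σ i j} (u v : Fin n) → Rows σ → i ≡ toℕ u → j ≡ toℕ v →
    nat σ 2 (nat σ 3 i + j) ≡ w u v
  w-cell {σ} u v rows@((_ , _ , _ , _ , w≡ , _) , _) i≡ j≡ =
    trans (cong (nat σ 2) (cell {σ} u v rows i≡ j≡)) (w≡ u v)

  p-cell : ∀ {σ i j} (u v : Fin n) → Rows σ → i ≡ toℕ u → j ≡ toℕ v →
    rat σ 1 (nat σ 3 i + j) ≡ p u v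
  p-cell {σ} u v rows@((_ , _ , _ , _ , _ , _ , p≡) , _) i≡ j≡ =
    trans (cong (rat σ 1) (cell {σ} u v rows i≡ j≡)) (p≡ u v)

  -- Verification of sort

  ReadyUpTo : (ℕ → ℕ) → Fin n → ℕ → Set
  ReadyUpTo mark u j =
    mark (toℕ u) ≡ 0 × (∀ v → toℕ v < j → bit (adj u v) ∸ mark (toℕ v) ≡ 0)

  ready-suc : ∀ {mark u} v → ReadyUpTo mark u (toℕ v) → bit (adj u v) ∸ mark (toℕ v) ≡ 0 →
    ReadyUpTo mark u (suc (toℕ v))
  ready-suc {mark} {u} v (m≡ , below) here = m≡ , below′
    where
    below′ : ∀ x → toℕ x < suc (toℕ v) → bit (adj u x) ∸ mark (toℕ x) ≡ 0
    below′ x (s≤s x≤v) with m≤n⇒m<n∨m≡n x≤v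
    ... | inj₁ x<v = below x x<v
    ... | inj₂ x≡v with refl ← Fin.toℕ-injective x≡v = here

  -- `#x` is not reset between rounds, so its value means nothing until a ready vertex has been met;
  -- hence the second alternative.
  Found : ℕ → ℕ → (ℕ → ℕ) → Set
  Found j x mark =
    (∃[ y ] x ≡ toℕ y × ReadyUpTo mark y n) ⊎ (∀ y → toℕ y < j → ¬ ReadyUpTo mark y n)

  record Sorted (o : ℕ → Fin n) (k : ℕ) (ord mark : ℕ → ℕ) : Set where
    field
      topological : Topological o k
      ordered     : ∀ {j} → j < k → ord j ≡ toℕ (o j)
      marked      : ∀ v → mark (toℕ v) ≡ bit (does (listed? o k v))

    mark-listed : ∀ {v} → Listed o k v → mark (toℕ v) ≡ 1
    mark-listed {v} l with listed? o k v | marked v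
    ... | yes _ | eq = eq
    ... | no ¬l | _  = contradiction l ¬l

    mark-unlisted : ∀ {v} → ¬ Listed o k v → mark (toℕ v) ≡ 0
    mark-unlisted {v} ¬l with listed? o k v | marked v
    ... | yes l | _  = contradiction l ¬l
    ... | no _  | eq = eq

    -- This is why no round of `sort` fails: a vertex maximal among the unlisted ones is ready.
    ready-exists : k < n → ∃[ x ] ReadyUpTo mark x n
    ready-exists k<n =
      let u , ¬lu = some-unlisted o k k<n
          x , ¬lx , max = maximal (λ v → ¬? (listed? o k v)) u ¬lu
      in x , mark-unlisted ¬lx , λ v _ → below x v (max v)
      where
      below : ∀ x v → (Arc x v → ¬ ¬ Listed o k v) → bit (adj x v) ∸ mark (toℕ v) ≡ 0
      below x v h with adj x v | listed? o k v
      ... | false | _     = 0∸n≡0 (mark (toℕ v))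
      ... | true  | yes l = cong (1 ∸_) (mark-listed l)
      ... | true  | no ¬l = contradiction ¬l (h tt)

    ready-unlisted : ∀ {x} → ReadyUpTo mark x n → ¬ Listed o k x
    ready-unlisted (m≡0 , _) l = contradiction (trans (sym m≡0) (mark-listed l)) λ ()

    ready-arcs : ∀ {x} → ReadyUpTo mark x n → ∀ v → Arc x v → Listed o k v
    ready-arcs (_ , below) v a with listed? o k v
    ... | yes l = l
    ... | no ¬l = contradiction
      (trans (sym (cong₂ _∸_ (T-bit a) (mark-unlisted ¬l))) (below v (Fin.toℕ<n v))) λ ()

  open Sorted

  sorted-extend : ∀ {o k i x m m′} y → i ≡ k → x ≡ toℕ y → ReadyUpTo (m′ 4) y n →
    Sorted o k (m 5) (m′ 4) → Sorted (extend o k y) (suc k) (update m 5 i x 5) (update m′ 4 x 1 4)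
  sorted-extend {o} {k} {m = m} {m′} y refl refl ready S = record
    { topological = topological-extend (topological S) (ready-unlisted S ready) (ready-arcs S ready)
    ; ordered     = ordered′
    ; marked      = marked′
    }
    where
    ordered′ : ∀ {j} → j < suc k → update m 5 k (toℕ y) 5 j ≡ toℕ (extend o k y j)
    ordered′ j<1+k with <-suc-case j<1+k
    ... | inj₁ j<k  = trans (update-other 5 (<⇒≢ j<k ∘ sym))
      (trans (ordered S j<k) (cong toℕ (sym (extend-old o y j<k))))
    ... | inj₂ refl = trans (update-same m 5 k) (cong toℕ (sym (extend-new o k y)))

    marked′ : ∀ v → update m′ 4 (toℕ y) 1 4 (toℕ v) ≡ bit (does (listed? (extend o k y) (suc k) v))
    marked′ v with y Fin.≟ v | listed? (extend o k y) (suc k) v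
    ... | yes refl | yes _ = update-same m′ 4 (toℕ y)
    ... | yes refl | no ¬l = contradiction (k , ≤-refl , extend-new o k y) ¬l
    ... | no y≢v | yes l = trans (update-other 4 (y≢v ∘ Fin.toℕ-injective)) (mark-listed S old)
      where
      old : Listed o k v
      old with listed-suc l
      ... | inj₁ h   = h
      ... | inj₂ y≡v = contradiction y≡v y≢v
    ... | no y≢v | no ¬l = trans (update-other 4 (y≢v ∘ Fin.toℕ-injective))
      (mark-unlisted S λ { (j , j<k , eq) → ¬l (j , m≤n⇒m≤1+n j<k , trans (extend-old o y j<k) eq) })

  SortInv : (ℕ → Fin n) → ℕ → Store → Set
  SortInv o k σ = Rows σ × Fresh σ × Sorted o k (nat σ 5) (nat σ 4)

  ScanInv : (ℕ → Fin n) → ℕ → ℕ → Store → Set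
  ScanInv o k j σ = SortInv o k σ × nat σ 10 0 ≡ k × Found j (nat σ 13 0) (nat σ 4)

  scan-correct : ∀ {o k} (u : Fin n) {σ} → nat σ 11 0 ≡ toℕ u → ScanInv o k (toℕ u) σ →
    Exec scan σ (5 + (forCost 2 n 16 + 10))
      (λ τ → nat τ 11 0 ≡ toℕ u × ScanInv o k (suc (toℕ u)) (set 11 (nat τ 11 0 + 1) τ))
  scan-correct {o} {k} u {σ} u≡ inv =
    assignᴺ (inv , u≡ , (λ m≡ → trans (sym (cong (nat σ 4) u≡)) m≡ , λ _ ())
                      , (λ (m≡ , _) → trans (cong (nat σ 4) u≡) m≡)) ≫ λ q →
    for-Fin I (λ (((((n≡ , _) , _) , _) , _) , _) → n≡) body q ≫
    finish
    where
    I : ℕ → Store → Set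
    I j σ = ScanInv o k (toℕ u) σ × nat σ 11 0 ≡ toℕ u ×
      (nat σ 14 0 ≡ 0 → ReadyUpTo (nat σ 4) u j) × (ReadyUpTo (nat σ 4) u j → nat σ 14 0 ≡ 0)

    body : ∀ (v : Fin n) {σ} → nat σ 12 0 ≡ toℕ v → I (toℕ v) σ →
      Exec (14 [ lit 0 ]≔ᴺ #bad ⊕ (#adj #u ⊖ 4 [ #v ]ᴺ)) σ 16
        (λ τ → nat τ 12 0 ≡ toℕ v × I (suc (toℕ v)) (set 12 (nat τ 12 0 + 1) τ))
    body v {σ} v≡ (inv@((rows , _) , _) , u≡ , to , from) = assignᴺ
      ( v≡ , inv , u≡
      , (λ eq → ready-suc {nat σ 4} {u} v (to (m+n≡0⇒m≡0 _ eq)) (trans (sym here) (m+n≡0⇒n≡0 (nat σ 14 0) eq)))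
      , (λ (m≡ , below) → cong₂ _+_ (from (m≡ , λ x x<v → below x (m≤n⇒m≤1+n x<v)))
                                   (trans here (below v ≤-refl))) )
      where
      here = cong₂ _∸_ (adj-cell {σ} u v rows u≡ v≡) (cong (nat σ 4) v≡)

    finish : ∀ {σ} → I n σ → Exec (if #bad ≤ᴺ lit 0 then 13 [ lit 0 ]≔ᴺ #u else skip) σ 10
      (λ τ → nat τ 11 0 ≡ toℕ u × ScanInv o k (suc (toℕ u)) (set 11 (nat τ 11 0 + 1) τ))
    finish {σ} ((sorted , k≡ , found) , u≡ , to , from) = branch
      (λ bad≤0 → assignᴺ (u≡ , sorted , k≡ , inj₁ (u , u≡ , to (n≤0⇒n≡0 bad≤0))))
      (λ bad≰0 → done (u≡ , sorted , k≡ , skipped {mark = nat σ 4} found (bad≰0 ∘ ≤-reflexive ∘ from)))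
      where
      skipped : ∀ {x mark} → Found (toℕ u) x mark → ¬ ReadyUpTo mark u n → Found (suc (toℕ u)) x mark
      skipped (inj₁ h)    _      = inj₁ h
      skipped {mark = mark} (inj₂ none) ¬ready = inj₂ none′
        where
        none′ : ∀ y → toℕ y < suc (toℕ u) → ¬ ReadyUpTo mark y n
        none′ y (s≤s y≤u) with m≤n⇒m<n∨m≡n y≤u
        ... | inj₁ y<u = none y y<u
        ... | inj₂ y≡u with refl ← Fin.toℕ-injective y≡u = ¬ready

  sort-correct : ∀ {σ} → Rows σ → (∀ i → nat σ 4 i ≡ 0) → Fresh σ →
    Exec sort σ (forCost 2 n (forCost 2 n (5 + (forCost 2 n 16 + 10)) + 9))
      (λ τ → ∃[ o ] SortInv o n τ)
  sort-correct {σ} rows unmarked fr =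
    for-Fin I (λ (_ , ((n≡ , _) , _) , _) → n≡) body
      -- Nothing is listed yet, so the order can start from any default vertex.
      ((λ _ → s) , rows , fr , record
        { topological = topological-zero _ ; ordered = λ () ; marked = marked₀ })
    where
    I : ℕ → Store → Set
    I k σ = ∃[ o ] SortInv o k σ

    marked₀ : ∀ v → nat σ 4 (toℕ v) ≡ bit (does (listed? (λ _ → s) 0 v))
    marked₀ v with listed? (λ _ → s) 0 v
    ... | no _ = unmarked (toℕ v)

    body : ∀ (i : Fin n) {σ} → nat σ 10 0 ≡ toℕ i → I (toℕ i) σ → Exec _ σ _
      (λ τ → nat τ 10 0 ≡ toℕ i × I (suc (toℕ i)) (set 10 (nat τ 10 0 + 1) τ))
    body i i≡ (o , sorted) =
      for-Fin (ScanInv o (toℕ i)) (λ ((((n≡ , _) , _) , _) , _) → n≡) (scan-correct {o})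
        (sorted , i≡ , inj₂ λ _ ()) ≫ λ ((rows , fr , S) , i≡ , found) →
      let y , x≡ , ready = select S found in
      assignᴺ (i≡ , rows , fr , sorted-extend y i≡ x≡ ready S) ≫ λ q →
      assignᴺ (proj₁ q , extend o (toℕ i) y , proj₂ q)
      where
      select : ∀ {ord mark x} → Sorted o (toℕ i) ord mark → Found n x mark →
        ∃[ y ] x ≡ toℕ y × ReadyUpTo mark y n
      select S (inj₁ h)    = h
      select S (inj₂ none) = let x , ready = ready-exists S (Fin.toℕ<n i) in
        contradiction ready (none x (Fin.toℕ<n x))

  -- Verification of distances

  -- `α` and `ω` stand for the values read from memory. Keeping their equations as hypotheses lets
  -- `refl` replace them without rewriting inside a store.
  relax-then : ∀ {u v α ω e f} → α ≡ bit (adj u v) → ω ≡ w u v → (Arc u v → Code v f) →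
    1 ≤ α × 1 ≤ f × ¬ (1 ≤ e × e ≤ ω + f) →
    Encodes (Starts (toℕ v)) u e → Encodes (Starts (suc (toℕ v))) u (ω + f)
  relax-then refl refl code (1≤α , 1≤f , better) =
    code-update (bit-≤ 1≤α) (code (bit-≤ 1≤α)) 1≤f better

  relax-else : ∀ {u v α ω e f} → α ≡ bit (adj u v) → ω ≡ w u v → (Arc u v → Code v f) →
    ¬ (1 ≤ α × 1 ≤ f × ¬ (1 ≤ e × e ≤ ω + f)) →
    Encodes (Starts (toℕ v)) u e → Encodes (Starts (suc (toℕ v))) u e
  relax-else {u} {v} {e = e} {f} refl refl code ¬cond = code-keep code minimal
    where
    minimal : Arc u v → 1 ≤ f → 1 ≤ e × e ≤ w u v + f
    minimal a 1≤f with 1 ≤? e ×-dec e ≤? w u v + f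
    ... | yes h = h
    ... | no ¬h = contradiction (≤-reflexive (sym (T-bit a)) , 1≤f , ¬h) ¬cond

  Ordered : (ℕ → Fin n) → Store → Set
  Ordered o σ = ∀ {j} → j < n → nat σ 5 j ≡ toℕ (o j)

  DistInv : (ℕ → Fin n) → ℕ → Store → Set
  DistInv o i σ = Rows σ × Fresh σ × Ordered o σ ×
    (∀ {j} → j < i → Code (o j) (nat σ 6 (toℕ (o j))))

  distances-correct : ∀ {o σ} → Topological o n → Rows σ → Fresh σ → Ordered o σ →
    Exec distances σ (forCost 2 n (5 + (15 + (forCost 2 n 51 + 5)))) (DistInv o n)
  distances-correct {o} top rows fr ord =
    for-Fin (DistInv o) (λ (((n≡ , _) , _) , _) → n≡) body (rows , fr , ord , λ ())
    where
    module _ (i : Fin n) where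
      x : Fin n
      x = o (toℕ i)

      I : ℕ → Store → Set
      I j σ = DistInv o (toℕ i) σ × nat σ 10 0 ≡ toℕ i × nat σ 13 0 ≡ toℕ x ×
        Encodes (Starts j) x (nat σ 15 0)

      relax-correct : ∀ (v : Fin n) {σ} → nat σ 12 0 ≡ toℕ v → I (toℕ v) σ →
        Exec relax σ 51
          (λ τ → nat τ 12 0 ≡ toℕ v × I (suc (toℕ v)) (set 12 (nat τ 12 0 + 1) τ))
      relax-correct v {σ} v≡ (inv@(rows , _ , _ , codes) , i≡ , x≡ , enc) = branch
        (λ c → assignᴺ (v≡ , inv , i≡ , x≡ , relax-then α≡ ω≡ code c enc))
        (λ ¬c → done (v≡ , inv , i≡ , x≡ , relax-else α≡ ω≡ code ¬c enc))
        where
        α≡ = adj-cell {σ} x v rows x≡ v≡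
        ω≡ = w-cell {σ} x v rows x≡ v≡

        code : Arc x v → Code v (nat σ 6 (nat σ 12 0))
        -- The order pays off here: the head of the arc is an earlier entry, so its code is final.
        code a with j , j<i , refl ← Topological.arcs top (Fin.toℕ<n i) a =
          subst (Code v) (cong (nat σ 6) (sym v≡)) (codes j<i)

    codes-suc : ∀ {m i x e} → i < n → x ≡ toℕ (o i) → Code (o i) e →
      (∀ {j} → j < i → Code (o j) (m 6 (toℕ (o j)))) →
      ∀ {j} → j < suc i → Code (o j) (update m 6 x e 6 (toℕ (o j)))
    codes-suc {m} {i} {e = e} i<n refl code codes j<1+i with <-suc-case j<1+i
    ... | inj₁ j<i  = subst (Code _)
      (sym (update-other 6 (Topological.distinct top j<i i<n ∘ sym ∘ Fin.toℕ-injective))) (codes j<i)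
    ... | inj₂ refl = subst (Code _) (sym (update-same m 6 (toℕ (o i)))) code

    body : ∀ (i : Fin n) {σ} → nat σ 10 0 ≡ toℕ i → DistInv o (toℕ i) σ → Exec _ σ _
      (λ τ → nat τ 10 0 ≡ toℕ i × DistInv o (suc (toℕ i)) (set 10 (nat τ 10 0 + 1) τ))
    body i {σ} i≡ inv@(_ , _ , ord , _) =
      assignᴺ {Q = λ τ → DistInv o (toℕ i) τ × nat τ 10 0 ≡ toℕ i × nat τ 13 0 ≡ toℕ (x i)}
        (inv , i≡ , trans (cong (nat σ 5) i≡) (ord (Fin.toℕ<n i)))
        ≫ λ {τ} (inv@(((_ , _ , t≡ , _) , _) , _) , i≡ , x≡) →
      assignᴺ (inv , i≡ , x≡ ,
        subst (Encodes (Starts 0) (x i)) (sym (cong₂ kronecker x≡ t≡)) (code-init (x i)))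
        ≫ λ q →
      for-Fin (I i) (λ ((((n≡ , _) , _) , _) , _) → n≡) (relax-correct i) q
        ≫ λ {τ} ((rows , fr , ord , codes) , i≡ , x≡ , enc) →
      assignᴺ (i≡ , rows , fr , ord ,
        codes-suc {m = nat τ} (Fin.toℕ<n i) x≡ (code-finish enc) (λ {j} → codes {j}))

  -- Verification of threshold and table

  Levels : ℕ → Store → Set
  Levels N σ = nat σ 16 0 ≡ N × (∀ {b} → b ≤ N → nat σ 7 b ≡ b * n)

  -- Paths from o j visit only earlier vertices, hence have at most j arcs: this is
  -- why an entry agrees with F k for all k > j at once.
  TableInv : (ℕ → Fin n) → ℕ → ℕ → Store → Set
  TableInv o N i σ = Rows σ × Ordered o σ × Levels N σ ×
    (∀ {j b k} → j < i → b ≤ N → j < k → rat σ 2 (b * n + toℕ (o j)) ≡ F k (o j) b)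

  threshold-correct : ∀ {o σ d} .{{_ : NonZero d}} → 0ℚ ≤ℚ W →
    Rows σ → Fresh σ → Ordered o σ → nat σ 6 (toℕ s) ≡ suc d →
    Exec threshold σ (whileCost 16 ⌊ W · d ⌋ 17) (TableInv o ⌊ W · d ⌋ 0)
  threshold-correct {o} {σ} {d} 0≤W rows (m₀≡ , B≡) ord d≡ =
    conseq (λ (rows , ord , _ , levels) → rows , (λ {j} → ord {j}) , levels , λ ())
      (while-rule I (λ {_} {σ} → test {σ = σ}) step (rows , (λ {j} → ord {j}) , d≡ , B≡ , λ { {zero} _ → m₀≡ }))
    where
    I : ℕ → Store → Set
    I i σ = Rows σ × Ordered o σ × nat σ 6 (toℕ s) ≡ suc d × Levels i σ

    test : ∀ {i σ} → I i σ →
      ((nat σ 16 0 + 1) /1 ≤ℚ rat σ 0 1 ℚ.* (nat σ 6 (nat σ 0 1) ∸ 1) /1 → i < ⌊ W · d ⌋) ×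
      (i < ⌊ W · d ⌋ → (nat σ 16 0 + 1) /1 ≤ℚ rat σ 0 1 ℚ.* (nat σ 6 (nat σ 0 1) ∸ 1) /1)
    test {i} {σ} (((_ , s≡ , _ , _ , _ , W≡ , _) , _) , _ , d≡ , B≡ , _)
      rewrite s≡ | d≡ | B≡ | W≡ | +-comm i 1 =
      let to , from = floor-adjoint (suc i) (W ℚ.* d /1) (·-nonNeg W d 0≤W) in from , to

    step : ∀ {i σ} → i < ⌊ W · d ⌋ → I i σ → Exec _ σ 17 (I (suc i))
    step {i} {σ} _ (rows , ord , d≡ , B≡ , mult) =
      assignᴺ {Q = λ τ → Rows τ × Ordered o τ × nat τ 6 (toℕ s) ≡ suc d × nat τ 16 0 ≡ i ×
                         (∀ {b} → b ≤ suc i → nat τ 7 b ≡ b * n)}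
        (rows , (λ {j} → ord {j}) , d≡ , B≡ ,
          λ {b} → multiples-suc {nat σ} 7 (cong (_+ 1) B≡)
            (cong₂ _+_ (proj₁ (proj₁ rows)) (trans (cong (nat σ 7) B≡) (mult ≤-refl))) mult {b})
        ≫ λ (rows , ord , d≡ , B≡ , mult) →
      assignᴺ (rows , (λ {j} → ord {j}) , d≡ , trans (cong (_+ 1) B≡) (+-comm i 1) , λ {b} → mult {b})

  partialSum : ℕ → Fin n → ℕ → ℕ → ℚ
  partialSum k u b j = kronecker (toℕ u) (toℕ t) /1 ℚ.+ prefixSum (arcTerm (F k) u b) j

  partialSum-suc : ∀ k u b v →
    partialSum k u b (suc (toℕ v)) ≡ partialSum k u b (toℕ v) ℚ.+ arcTerm (F k) u b v
  partialSum-suc k u b v =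
    trans (cong (kronecker (toℕ u) (toℕ t) /1 ℚ.+_) (prefixSum-suc (arcTerm (F k) u b) v))
          (sym (ℚ.+-assoc (kronecker (toℕ u) (toℕ t) /1) _ _))

  add-then : ∀ {u v b k α ω π f acc} → α ≡ bit (adj u v) → ω ≡ w u v → π ≡ p u v →
    1 ≤ α × ω ≤ b → (Arc u v → f ≡ F k v (b ∸ w u v)) → acc ≡ partialSum k u b (toℕ v) →
    acc ℚ.+ π ℚ.* f ≡ partialSum k u b (suc (toℕ v))
  add-then {u} {v} {b} {k} refl refl refl (1≤α , w≤b) f≡ refl =
    sym (trans (partialSum-suc k u b v) (cong (partialSum k u b (toℕ v) ℚ.+_)
      (trans (arcTerm-yes (F k) (bit-≤ 1≤α) w≤b) (cong (p u v ℚ.*_) (sym (f≡ (bit-≤ 1≤α)))))))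

  add-else : ∀ {u v b k α ω acc} → α ≡ bit (adj u v) → ω ≡ w u v →
    ¬ (1 ≤ α × ω ≤ b) → acc ≡ partialSum k u b (toℕ v) → acc ≡ partialSum k u b (suc (toℕ v))
  add-else {u} {v} {b} {k} refl refl ¬cond refl =
    sym (trans (partialSum-suc k u b v)
      (trans (cong (partialSum k u b (toℕ v) ℚ.+_)
               (arcTerm-no (F k) λ (a , w≤b) → ¬cond (≤-reflexive (sym (T-bit a)) , w≤b)))
             (ℚ.+-identityʳ _)))

  module Table {o : ℕ → Fin n} (top : Topological o n) (N : ℕ) (i : Fin n) where

    private
      x : Fin n
      x = o (toℕ i)

    RowInv : ℕ → Store → Set
    RowInv b σ = TableInv o N (toℕ i) σ × nat σ 10 0 ≡ toℕ i × nat σ 13 0 ≡ toℕ x ×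
      (∀ {c k} → c < b → toℕ i < k → rat σ 2 (c * n + toℕ x) ≡ F k x c)

    -- The bound is `toℕ i ≤ k`, whereas finished entries have `toℕ i < k`: by `F-suc`, the complete
    -- sum over `F k` is an entry of `F (suc k)`.
    SumInv : ℕ → ℕ → Store → Set
    SumInv b j σ = RowInv b σ × nat σ 11 0 ≡ b ×
      (∀ {k} → toℕ i ≤ k → rat σ 3 0 ≡ partialSum k x b j)

    addArc-correct : ∀ {b} → b ≤ N → (v : Fin n) → ∀ {σ} →
      nat σ 12 0 ≡ toℕ v → SumInv b (toℕ v) σ →
      Exec addArc σ 50
        (λ τ → nat τ 12 0 ≡ toℕ v × SumInv b (suc (toℕ v)) (set 12 (nat τ 12 0 + 1) τ))
    addArc-correct {b} b≤N v {σ} v≡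
      (row@((rows , _ , (_ , mult) , table) , _ , x≡ , _) , b≡ , acc≡) = branch
      (λ (1≤α , ω≤b) → assignᴿ (v≡ , row , b≡ , λ {k} i≤k →
        add-then {k = k} α≡ ω≡ π≡ (1≤α , ≤-trans ω≤b (≤-reflexive b≡)) (entry i≤k) (acc≡ i≤k)))
      (λ ¬c → done (v≡ , row , b≡ , λ {k} i≤k →
        add-else {k = k} α≡ ω≡ (λ (1≤α , ω≤b) → ¬c (1≤α , ≤-trans ω≤b (≤-reflexive (sym b≡)))) (acc≡ i≤k)))
      where
      α≡ = adj-cell {σ} x v rows x≡ v≡
      ω≡ = w-cell {σ} x v rows x≡ v≡
      π≡ = p-cell {σ} x v rows x≡ v≡

      entry : ∀ {k} → toℕ i ≤ k → Arc x v →
        rat σ 2 (nat σ 7 (nat σ 11 0 ∸ nat σ 2 (nat σ 3 (nat σ 13 0) + nat σ 12 0)) + nat σ 12 0)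
          ≡ F k v (b ∸ w x v)
      entry i≤k a with j , j<i , refl ← Topological.arcs top (Fin.toℕ<n i) a = trans
        (cong (rat σ 2) (cong₂ _+_ (trans (cong (nat σ 7) (cong₂ _∸_ b≡ ω≡)) (mult c≤N)) v≡))
        (table j<i c≤N (<-≤-trans j<i i≤k))
        where
        c≤N = ≤-trans (m∸n≤m b (w x v)) b≤N

    write-other : ∀ {m : ℕ → ℕ → ℚ} {r b y a} c (v : Fin n) → r ≡ b * n → y ≡ toℕ x →
      ¬ (b ≡ c × x ≡ v) → update m 2 (r + y) a 2 (c * n + toℕ v) ≡ m 2 (c * n + toℕ v)
    write-other {b = b} c v refl refl ≢ = update-other 2 (≢ ∘ row-injective b c x v)

    write-same : ∀ {m : ℕ → ℕ → ℚ} {r b y a} → r ≡ b * n → y ≡ toℕ x →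
      update m 2 (r + y) a 2 (b * n + toℕ x) ≡ a
    write-same {m} {b = b} refl refl = update-same m 2 (b * n + toℕ x)

    sumArcs-correct : ∀ {b σ} → b < suc N → nat σ 11 0 ≡ b → RowInv b σ →
      Exec sumArcs σ (16 + (forCost 2 n 50 + 9))
        (λ τ → nat τ 11 0 ≡ b × RowInv (suc b) (set 11 (nat τ 11 0 + 1) τ))
    sumArcs-correct {b} {σ} (s≤s b≤N) b≡ row@((((_ , _ , t≡ , _) , _) , _) , _ , x≡ , _) =
      assignᴿ (row , b≡ , λ {k} _ → start k) ≫ λ q →
      for-Fin (SumInv b) (λ (((((n≡ , _) , _) , _) , _) , _) → n≡) (addArc-correct b≤N) q ≫
      finish
      where
      start : ∀ k → kronecker (nat σ 13 0) (nat σ 0 2) /1 ≡ partialSum k x b 0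
      start k = trans (cong _/1 (cong₂ kronecker x≡ t≡))
        (sym (trans (cong (kronecker (toℕ x) (toℕ t) /1 ℚ.+_) (prefixSum-zero (arcTerm (F k) x b)))
                    (ℚ.+-identityʳ _)))

      finish : ∀ {σ} → SumInv b n σ → Exec (2 [ 7 [ #u ]ᴺ ⊕ #x ]≔ᴿ 3 [ lit 0 ]ᴿ) σ 9
        (λ τ → nat τ 11 0 ≡ b × RowInv (suc b) (set 11 (nat τ 11 0 + 1) τ))
      finish {σ} (((rows , ord , levels@(_ , mult) , table) , i≡ , x≡ , row) , b≡ , acc≡) =
        assignᴿ (b≡ , (rows , (λ {j} → ord {j}) , levels , table′) , i≡ , x≡ , row′)
        where
        level : nat σ 7 (nat σ 11 0) ≡ b * n
        level = trans (cong (nat σ 7) b≡) (mult b≤N)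

        new = update (rat σ) 2 (nat σ 7 (nat σ 11 0) + nat σ 13 0) (rat σ 3 0) 2

        table′ : ∀ {j c k} → j < toℕ i → c ≤ N → j < k → new (c * n + toℕ (o j)) ≡ F k (o j) c
        table′ {j} {c} j<i c≤N j<k = trans
          (write-other {rat σ} {b = b} c (o j) level x≡
            λ (_ , x≡oj) → Topological.distinct top j<i (Fin.toℕ<n i) (sym x≡oj))
          (table j<i c≤N j<k)

        row′ : ∀ {c k} → c < suc b → toℕ i < k → new (c * n + toℕ x) ≡ F k x c
        row′ {c} {suc k} c<1+b i<k@(s≤s i≤k) with <-suc-case c<1+b
        ... | inj₁ c<b  = trans (write-other {rat σ} {b = b} c x level x≡ λ (b≡c , _) → <⇒≢ c<b (sym b≡c))
                                (row c<b i<k)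
        ... | inj₂ refl = trans (write-same {rat σ} {b = b} level x≡) (trans (acc≡ i≤k) (sym (F-suc k x b)))

  table-correct : ∀ {o N σ} → Topological o n → TableInv o N 0 σ →
    Exec table σ (forCost 2 n (5 + forCost 4 (suc N) (16 + (forCost 2 n 50 + 9)))) (TableInv o N n)
  table-correct {o} {N} top =
    for-Fin (TableInv o N) (λ (((n≡ , _) , _) , _) → n≡) body
    where
    body : ∀ (i : Fin n) {σ} → nat σ 10 0 ≡ toℕ i → TableInv o N (toℕ i) σ → Exec _ σ _
      (λ τ → nat τ 10 0 ≡ toℕ i × TableInv o N (suc (toℕ i)) (set 10 (nat τ 10 0 + 1) τ))
    body i {σ} i≡ inv@(_ , ord , _) =
      assignᴺ (inv , i≡ , trans (cong (nat σ 5) i≡) (ord (Fin.toℕ<n i)) , λ ()) ≫ λ q →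
      conseq (λ {τ} ((rows , ord , levels , table) , i≡ , _ , row) →
          i≡ , rows , (λ {j} → ord {j}) , levels , λ {_} {b} j<1+i b≤N →
            merge {λ j k → rat τ 2 (b * n + toℕ (o j)) ≡ F k (o j) b}
              (λ j<i → table j<i b≤N) (row (s≤s b≤N)) (<-suc-case j<1+i))
        (for-rule RowInv (λ ((_ , _ , (B≡ , _) , _) , _) → trans (cong (_+ 1) B≡) (+-comm N 1))
          sumArcs-correct q)
      where
      open Table top N i

      merge : ∀ {P : ℕ → ℕ → Set} {j k} → (j < toℕ i → j < k → P j k) → (toℕ i < k → P (toℕ i) k) →
        j < toℕ i ⊎ j ≡ toℕ i → j < k → P j k
      merge f g (inj₁ j<i)  = f j<i
      merge f g (inj₂ refl) = g

  -- Correctness and cost of the whole program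

  eciCost : ℕ → ℕ
  eciCost N =
    -- The first argument of `forCost` is the cost of the limit, `2` for `#n` and `4` for
    -- `#B ⊕ lit 1`. The other numerals count straight-line pieces and conditionals, the latter with
    -- both branches.
    forCost 2 n 11 +
    (forCost 2 n (forCost 2 n (5 + (forCost 2 n 16 + 10)) + 9) +
    (forCost 2 n (5 + (15 + (forCost 2 n 51 + 5))) +
    (whileCost 16 N 17 +
    (forCost 2 n (5 + forCost 4 (suc N) (16 + (forCost 2 n 50 + 9))) + 9))))

  eci-correct : 0ℚ ≤ℚ W → ∀ d .{{_ : NonZero d}} → IsDistance s t d →
    Exec eci (input M W) (eciCost ⌊ W · d ⌋) (λ τ → output τ ≡ F n s ⌊ W · d ⌋)
  eci-correct 0≤W d dist =
    multiples-correct input-holds refl (λ _ → refl) (refl , refl)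
      ≫ λ (rows , unmarked , fr) →
    sort-correct rows unmarked fr
      ≫ λ (o , rows , fr , S) →
    let top = topological S
        -- The codes and the table are known for entries of the order only, so `s` has to be located
        -- in it.
        j , j<n , oj≡s = all-listed top s
    in
    distances-correct top rows fr (ordered S)
      ≫ λ {τ} (rows , fr , ord , codes) →
    threshold-correct 0≤W rows fr (λ {i} → ord {i})
      (code-distance dist (subst (λ u → Code u (nat τ 6 (toℕ u))) oj≡s (codes j<n)))
      ≫ λ inv →
    table-correct {N = ⌊ W · d ⌋} top inv
      ≫ λ {τ} (((_ , s≡ , _) , _) , _ , (B≡ , mult) , entries) →
    assignᴿ (trans
      (cong (rat τ 2) (cong₂ _+_ (trans (cong (nat τ 7) B≡) (mult ≤-refl)) s≡))
      (subst (λ u → rat τ 2 (⌊ W · d ⌋ * n + toℕ u) ≡ F n u ⌊ W · d ⌋) oj≡s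
        -- The second `j<n` selects the depth `k = n`, the one at which `paths` enumerates.
        (entries j<n ≤-refl j<n)))

-- Running time

eciCost-bound : ∀ {n} (M : Model n) W N → eciCost M W N ≼ 494 · (N * n ^ 2 + n ^ 3)
eciCost-bound {n} M W N =
  -- One summand per phase and one for the final copy: 494 = 36 + 115 + 126 + 49 + 159 + 9.
  +-bound (scale n≤ (forCost-bound 2 {n} 1≤n ≤-refl (const-bound 11 ≤-refl))) (
  +-bound (scale n³≤ sort-bound) (
  +-bound (scale n²≤ distances-bound) (
  +-bound threshold-bound (
  +-bound (scale table≤ table-bound) (const-bound 9 (≤-trans 1≤n² n²≤))))))
  where
  X : ℕ
  X = N * n ^ 2 + n ^ 3

  1≤n : 1 ≤ n
  1≤n = ≤-trans (s≤s z≤n) (Fin.toℕ<n (Model.s M))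

  1≤n¹ : 1 ≤ n ^ 1
  1≤n¹ = *-mono-≤ 1≤n (≤-refl {1})

  1≤n² : 1 ≤ n ^ 2
  1≤n² = *-mono-≤ 1≤n 1≤n¹

  grow : ∀ k → n ^ k ≤ n ^ suc k
  grow k = ≤-trans (≤-reflexive (sym (*-identityˡ (n ^ k)))) (*-monoˡ-≤ (n ^ k) 1≤n)

  n³≤ : n ^ 3 ≤ X
  n³≤ = m≤n+m (n ^ 3) (N * n ^ 2)

  n²≤ : n ^ 2 ≤ X
  n²≤ = ≤-trans (grow 2) n³≤

  n≤ : n * 1 ≤ X
  n≤ = ≤-trans (grow 1) n²≤

  table≤ : n * (suc N * n ^ 1) ≤ X
  table≤ = begin
    n * (suc N * n ^ 1) ≡⟨ *-assoc n (suc N) (n ^ 1) ⟨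
    n * suc N * n ^ 1   ≡⟨ cong (_* n ^ 1) (*-comm n (suc N)) ⟩
    suc N * n * n ^ 1   ≡⟨ *-assoc (suc N) n (n ^ 1) ⟩
    -- There are `N + 1` budgets; the additional `n ^ 2` is charged to `n ^ 3`, which also covers
    -- the case `N = 0`.
    n ^ 2 + N * n ^ 2   ≤⟨ +-monoˡ-≤ (N * n ^ 2) (grow 2) ⟩
    n ^ 3 + N * n ^ 2   ≡⟨ +-comm (n ^ 3) (N * n ^ 2) ⟩
    X                   ∎
    where open ≤-Reasoning

  sort-bound : forCost 2 n (forCost 2 n (5 + (forCost 2 n 16 + 10)) + 9) ≼ 115 · (n ^ 3)
  sort-bound =
    forCost-bound 2 {n} 1≤n 1≤n² (+-bound
      (forCost-bound 2 {n} 1≤n 1≤n¹ (+-bound (const-bound 5 1≤n¹) (+-bound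
        (forCost-bound 2 {n} 1≤n ≤-refl (const-bound 16 ≤-refl)) (const-bound 10 1≤n¹))))
      (const-bound 9 1≤n²))

  distances-bound : forCost 2 n (5 + (15 + (forCost 2 n 51 + 5))) ≼ 126 · (n ^ 2)
  distances-bound =
    forCost-bound 2 {n} 1≤n 1≤n¹ (+-bound (const-bound 5 1≤n¹)
      (+-bound (const-bound 15 1≤n¹) (+-bound
        (forCost-bound 2 {n} 1≤n ≤-refl (const-bound 51 ≤-refl)) (const-bound 5 1≤n¹))))

  threshold-bound : whileCost 16 N 17 ≼ 49 · X
  -- 33 = 16 + 17 is one test with one body; the other 16 is the last, failing test.
  threshold-bound = +-bound {K = 33}
    (bounded (≤-trans (≤-reflexive (*-comm N 33)) (*-monoʳ-≤ 33 N≤)))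
    (const-bound 16 (≤-trans 1≤n² n²≤))
    where
    N≤ : N ≤ X
    N≤ = begin
      N                   ≡⟨ *-identityʳ N ⟨
      N * 1               ≤⟨ *-monoʳ-≤ N 1≤n² ⟩
      N * n ^ 2           ≤⟨ m≤m+n (N * n ^ 2) (n ^ 3) ⟩
      X                   ∎
      where open ≤-Reasoning

  table-bound : forCost 2 n (5 + forCost 4 (suc N) (16 + (forCost 2 n 50 + 9)))
                  ≼ 159 · (n * (suc N * n ^ 1))
  table-bound =
    forCost-bound 2 {n} 1≤n 1≤row (+-bound (const-bound 5 1≤row)
      (forCost-bound 4 {suc N} (s≤s z≤n) 1≤n¹ entry-bound))
    where
    entry-bound : 16 + (forCost 2 n 50 + 9) ≼ 100 · (n ^ 1)
    entry-bound = +-bound (const-bound 16 1≤n¹) (+-bound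
      (forCost-bound 2 {n} 1≤n ≤-refl (const-bound 50 ≤-refl)) (const-bound 9 1≤n¹))

    1≤row : 1 ≤ suc N * n ^ 1
    1≤row = *-mono-≤ (s≤s (z≤n {N})) 1≤n¹

theorem4 : ∃[ prog ] ∃[ c ]
    (∀ (n : ℕ) (M : Model n) (W : ℚ) → 0ℚ ≤ℚ W →
    (d : ℕ) .{{_ : NonZero d}} → Model.IsDistance M (Model.s M) (Model.t M) d →
    ∃[ σ ] ∃[ steps ]
    (⟨ prog , input M W ⟩⇓⟨ σ , steps ⟩
    × output σ ≡ Model.Pr[X_≤_] M d W
    × steps ≤ c * (⌊ W · d ⌋ * n ^ 2 + n ^ 3)))
theorem4 = eci , 494 , λ n M W 0≤W d dist →
  let exec run bound post = eci-correct M W 0≤W d dist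
      bounded cost≤       = eciCost-bound M W ⌊ W · d ⌋
  in _ , _ , run , trans post (sym (PathSums.Pr≡F M d W 0≤W)) , ≤-trans bound cost≤
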